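{- Let $k\ge2$ and let $S^k$ be the $k$-uniform sunflower hypergraph. Then the spectrum of its Seidel matrix is $$\sigma_S(S^k)=\begin{pmatrix}1 & 2-k+\sqrt{(k+3)(k-1)} & 2-k-\sqrt{(k+3)(k-1)} & r_1 & r_2 & r_3\\ (k-1)(k-2) & k-2 & k-2 & 1&1&1\end{pmatrix},$$ where $r_1,r_2,r_3$ are the roots (with multiplicity) of the equation $$\lambda^3-(6-5k+k^2)\lambda^2-(-17+26k-12k^2+2k^3)\lambda-8+17k-11k^2+2k^3=0.$$
   Context: A hypergraph $G^*=(V,E)$ has a finite vertex set $V=\{v_1,\dots,v_N\}$ and a finite set $E$ of hyperedges, each a subset of $V$. Its adjacency matrix $A=(a_{ij})$ has $a_{ij}=|\{e\in E:\{v_i,v_j\}\subset e\}|$ for $i\ne j$ and $a_{ii}=0$. Its Seidel matrix is $S=J_N-I_N-2A$ ($J_N$ all-ones matrix, $I_N$ identity). The sunflower hypergraph $S^k$ is the $k$-uniform hypergraph of order $k(k-1)+1$ with vertices $v_{0,0}$ and $v_{i,j}$ ($1\le i\le k-1$, $1\le j\le k$) and hyperedges $\{v_{i,1},v_{i,2},\dots,v_{i,k}\}$ for $1\le i\le k-1$ together with $\{v_{0,0},v_{1,1},v_{2,1},\dots,v_{k-1,1}\}$. The two-row notation for a spectrum lists eigenvalues in the first row and multiplicities in the second; it is read as a multiset (if listed values coincide, their multiplicities add, and multiplicity $0$ means the entry is absent). -}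

module Defs where

open import Algebra.Apartness.Bundles using (HeytingField; HeytingCommutativeRing)
open import Algebra.Bundles using (CommutativeRing)
open import Data.Fin using (Fin; zero; suc; toℕ; combine; _≟_)
open import Data.Fin.Properties using (combine-injectiveˡ)
open import Data.Fin.Subset using (Subset; _∈_; _∪_; ⁅_⁆; ⋃)
open import Data.Fin.Subset.Properties
  using (_⊆?_; x∈⁅x⁆; x∈⁅y⁆⇒x≡y; x∈p∪q⁺; x∈p∪q⁻; ∉⊥)
open import Data.Integer as ℤ using (ℤ; +_; -[1+_])
open import Data.List using (List; []; _∷_; map; concatMap; replicate; filter; length; foldr; allFin)
open import Data.List.Membership.Propositional using () renaming (_∈_ to _∈ₗ_)
open import Data.List.Membership.Propositional.Properties using (∈-allFin; ∈-map⁺; ∈-map⁻)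
open import Data.List.Relation.Unary.All as All using ()
open import Data.List.Relation.Unary.All.Properties using () renaming (map⁺ to All-map⁺)
open import Data.List.Relation.Unary.AllPairs using (_∷_)
open import Data.List.Relation.Unary.Any using (here; there)
open import Data.List.Relation.Unary.Unique.Propositional using (Unique)
open import Data.List.Relation.Unary.Unique.Propositional.Properties
  using () renaming (map⁺ to Unique-map⁺; allFin⁺ to Unique-allFin⁺)
open import Data.Nat as ℕ using (ℕ; zero; suc; _∸_; NonZero; NonTrivial; nonTrivial⇒nonZero)
open import Data.Product using (_×_; _,_)
open import Data.Sum using (inj₁; inj₂)
open import Data.Vec.Functional using (Vector; removeAt)
open import Relation.Binary.PropositionalEquality using (_≡_; _≢_; refl; subst)
open import Relation.Nullary using (yes; no; contradiction)

Matrix : ∀ {a} → Set a → ℕ → Set a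
Matrix A n = Vector (Vector A n) n

-- `edges` enumerates the finite set of hyperedges without repetition.
record Hypergraph : Set where
  field
    order  : ℕ
    edges  : List (Subset order)
    unique : Unique edges

module _ (H : Hypergraph) where
  open Hypergraph H

  adjacency : Matrix ℤ order
  adjacency i j with i ≟ j
  ... | yes _ = + 0
  ... | no  _ = + length (filter ((⁅ i ⁆ ∪ ⁅ j ⁆) ⊆?_) edges)

allOnes : ∀ n → Matrix ℤ n
allOnes n i j = + 1

identity : ∀ n → Matrix ℤ n
identity n i j with i ≟ j
... | yes _ = + 1
... | no  _ = + 0

seidel : (H : Hypergraph) → Matrix ℤ (Hypergraph.order H)
seidel H i j = allOnes _ i j ℤ.- identity _ i j ℤ.- + 2 ℤ.* adjacency H i j

fromList : ∀ {n} → List (Fin n) → Subset n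
fromList xs = ⋃ (map ⁅_⁆ xs)

∈-fromList⁺ : ∀ {n x} {xs : List (Fin n)} → x ∈ₗ xs → x ∈ fromList xs
∈-fromList⁺ (here refl) = x∈p∪q⁺ (inj₁ (x∈⁅x⁆ _))
∈-fromList⁺ (there x∈xs) = x∈p∪q⁺ (inj₂ (∈-fromList⁺ x∈xs))

∈-fromList⁻ : ∀ {n x} (xs : List (Fin n)) → x ∈ fromList xs → x ∈ₗ xs
∈-fromList⁻ []       x∈ = contradiction x∈ ∉⊥
∈-fromList⁻ (y ∷ ys) x∈ with x∈p∪q⁻ ⁅ y ⁆ (fromList ys) x∈
... | inj₁ x∈⁅y⁆ = here (x∈⁅y⁆⇒x≡y y x∈⁅y⁆)
... | inj₂ x∈ys  = there (∈-fromList⁻ ys x∈ys)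

module Sunflower (k : ℕ) .{{_ : NonTrivial k}} where

  Vertex : Set
  Vertex = Fin (suc ((k ∸ 1) ℕ.* k))

  v₀₀ : Vertex
  v₀₀ = zero

  -- Both indices are shifted down by one: `v i j` is v_{i+1,j+1}.
  v : Fin (k ∸ 1) → Fin k → Vertex
  v i j = suc (combine i j)

  first : Fin k
  first = go k {{nonTrivial⇒nonZero k}}
    where
    go : ∀ n .{{_ : NonZero n}} → Fin n
    go (suc n) = zero

  petalVertices : Fin (k ∸ 1) → List Vertex
  petalVertices i = map (v i) (allFin k)

  coreVertices : List Vertex
  coreVertices = v₀₀ ∷ map (λ i → v i first) (allFin (k ∸ 1))

  petal : Fin (k ∸ 1) → Subset (suc ((k ∸ 1) ℕ.* k))
  petal i = fromList (petalVertices i)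

  core : Subset (suc ((k ∸ 1) ℕ.* k))
  core = fromList coreVertices

  petal-injective : ∀ {i i′} → petal i ≡ petal i′ → i ≡ i′
  petal-injective {i} {i′} eq =
    let (j , _ , vᵢ≡vᵢ′) = ∈-map⁻ (v i′) (∈-fromList⁻ (petalVertices i′) (subst (v i first ∈_) eq vᵢ∈))
    in combine-injectiveˡ i first i′ j (suc-inj vᵢ≡vᵢ′)
    where
    vᵢ∈ : v i first ∈ petal i
    vᵢ∈ = ∈-fromList⁺ {xs = petalVertices i} (∈-map⁺ (v i) (∈-allFin first))

    suc-inj : ∀ {n} {x y : Fin n} → Fin.suc x ≡ suc y → x ≡ y
    suc-inj refl = refl

  core≢petal : ∀ i → core ≢ petal i
  core≢petal i eq
    with (_ , _ , ()) ← ∈-map⁻ (v i) (∈-fromList⁻ (petalVertices i)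
           (subst (v₀₀ ∈_) eq (∈-fromList⁺ {xs = coreVertices} (here refl))))

  sunflower : Hypergraph
  sunflower = record
    { order  = suc ((k ∸ 1) ℕ.* k)
    ; edges  = core ∷ map petal (allFin (k ∸ 1))
    ; unique = All-map⁺ (All.universal core≢petal (allFin (k ∸ 1)))
             ∷ Unique-map⁺ petal-injective (Unique-allFin⁺ (k ∸ 1))
    }

open Sunflower public using (sunflower)

-- The real numbers enter only as a field of characteristic zero in which the
-- listed eigenvalues exist; the constructive reals are a `HeytingField`.
module Spectra {c ℓ₁ ℓ₂} (K : HeytingField c ℓ₁ ℓ₂) where

  open HeytingField K public using (Carrier; _≈_; _#_; _+_; _*_; -_; _-_; 0#; 1#)

  ring : CommutativeRing c ℓ₁
  ring = HeytingCommutativeRing.commutativeRing (HeytingField.heytingCommutativeRing K)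

  open CommutativeRing ring using (semiring; +-monoid)
  open import Algebra.Properties.Monoid.Mult +-monoid using () renaming (_×_ to _·_)
  open import Algebra.Properties.Monoid.Sum +-monoid using (sum)
  open import Algebra.Properties.Semiring.Exp semiring public using (_^_)

  CharacteristicZero : Set ℓ₂
  CharacteristicZero = ∀ n → .{{NonZero n}} → (n · 1#) # 0#

  ι : ℤ → Carrier
  ι (+ n)    = n · 1#
  ι -[1+ n ] = - (suc n · 1#)

  -- Laplace expansion along the first row.
  det : ∀ {n} → Matrix Carrier n → Carrier
  det {zero}  M = 1#
  det {suc n} M =
    sum λ j → (- 1#) ^ toℕ j * M zero j * det (λ i → removeAt (M (suc i)) j)

  charPoly : ∀ {n} → Matrix ℤ n → Carrier → Carrier
  charPoly A x = det (λ i j → x * ι (identity _ i j) - ι (A i j))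

  -- The monic polynomial p has exactly the roots rs, with multiplicity.
  -- Polynomials are represented by their functions, which is faithful as K is
  -- infinite when it has characteristic zero.
  RootsWithMultiplicity : (Carrier → Carrier) → List Carrier → Set _
  RootsWithMultiplicity p rs = ∀ x → p x ≈ foldr _*_ 1# (map (λ r → x - r) rs)

  -- Multiplicities are those of the roots of the characteristic polynomial; for
  -- a symmetric matrix over ℝ they agree with the geometric ones.
  HasSpectrum : ∀ {n} → Matrix ℤ n → List (Carrier × ℕ) → Set _
  HasSpectrum A table =
    RootsWithMultiplicity (charPoly A) (concatMap (λ (μ , m) → replicate m μ) table)

  sunflowerCubic : ℤ → Carrier → Carrier
  sunflowerCubic k x =
      x ^ 3
    - ι (+ 6 ℤ.- + 5 ℤ.* k ℤ.+ k ℤ.^ 2) * x ^ 2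
    - ι (ℤ.- + 17 ℤ.+ + 26 ℤ.* k ℤ.- + 12 ℤ.* k ℤ.^ 2 ℤ.+ + 2 ℤ.* k ℤ.^ 3) * x
    + ι (ℤ.- + 8 ℤ.+ + 17 ℤ.* k ℤ.- + 11 ℤ.* k ℤ.^ 2 ℤ.+ + 2 ℤ.* k ℤ.^ 3)

{-# OPTIONS --safe #-}
module Submission where

-- Give a column of x I - S a type (centre, core or leaf of a petal) together with
-- weights recording a sum of several columns of that type. If two vertices of
-- the same type are left, subtracting one row from the other and adding the
-- columns leaves a single entry d = x - 1 in that row, so the determinant is d
-- times the one with the two columns replaced by their sum. Doing this inside
-- each petal leaves a core vertex and one heavy leaf per petal and costs
-- d^{(k-1)(k-2)}. Two such petals are merged in the same way, at the cost of a
-- 2x2 determinant, (x - 2 + k)² - (k + 3)(k - 1), and k - 2 such merges leave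
-- a 3x3 determinant, which is the cubic.

open import Defs
open import Algebra.Apartness.Bundles using (HeytingField)
open import Algebra.Bundles using (CommutativeRing)
import Algebra.Solver.Ring
open import Algebra.Solver.Ring.AlmostCommutativeRing
  using (_-Raw-AlmostCommutative⟶_; fromCommutativeRing)
open import Data.Fin as Fin
  using (Fin; zero; suc; _≟_; combine; remQuot; toℕ; punchIn; _↑ˡ_; _↑ʳ_)
open import Data.Fin.Properties
  using (combine-remQuot; remQuot-combine; suc-injective; combine-injective)
open import Data.Fin.Subset using (Subset; _∈_; _∉_; _∪_; ⁅_⁆; _⊆_)
open import Data.Fin.Subset.Properties
  using (_⊆?_; x∈⁅x⁆; x∈⁅y⁆⇒x≡y; x∈p∪q⁺; x∈p∪q⁻)
open import Data.Integer as ℤ using (ℤ; +_; -[1+_])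
open import Data.Integer.Base using () renaming (+-*-rawRing to ℤ-rawRing)
import Data.Integer.Properties as ℤ
open import Data.List
  using ( List; []; _∷_; _++_; map; concat; concatMap; filter; foldr; length
        ; replicate; tabulate; allFin)
open import Data.List.Properties
  using ( ++-assoc; map-++; length-map; map-tabulate; length-tabulate; tabulate-cong
        ; filter-none; filter-accept; filter-reject)
open import Data.List.Membership.Propositional.Properties using (∈-allFin; ∈-map⁺; ∈-map⁻)
open import Data.List.Relation.Unary.All as All using (All; []; _∷_)
import Data.List.Relation.Unary.All.Properties as All
open import Data.List.Relation.Unary.AllPairs using (AllPairs; []; _∷_)
import Data.List.Relation.Unary.AllPairs.Properties as AllPairs
open import Data.List.Relation.Unary.Any using (here; there)
open import Data.List.Relation.Unary.Unique.Propositional using (Unique)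
import Data.List.Relation.Unary.Unique.Propositional.Properties as Unique
open import Data.Maybe using (Maybe; just; nothing)
open import Data.Nat as ℕ using (ℕ; zero; suc; _∸_; NonTrivial)
import Data.Nat.Properties as ℕ
open import Data.Product using (_×_; _,_; proj₁; proj₂)
open import Data.Sign as Sign using (Sign)
open import Data.Sum using (_⊎_; inj₁; inj₂)
open import Data.Vec.Functional using (Vector; removeAt)
open import Function using (_∘_; id; _on_)
open import Relation.Binary.PropositionalEquality as ≡ using (_≡_; _≢_; ≢-sym)
open import Relation.Nullary using (¬_; Dec; yes; no; contradiction)
open import Relation.Unary using (Pred; Decidable)

-- The characteristic polynomial is factored directly, so multiplicities appear as exponents and no
-- eigenvectors have to be found or shown independent. After the row subtraction for two leaves, the
-- expansion gives `d` times two determinants that differ in one column, and additivity joins them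
-- into one. The joined column is the true sum only at the surviving rows, because the entries tied
-- to the deleted vertex are lost. Hence labels must stay distinct, and additivity is asked only of
-- the rows still present. Two weights are needed because the merges differ: within a petal both
-- parts of an entry add up, while across petals the part tied to a single petal does not. Every
-- merge shrinks the matrix at an interior place, so determinants are taken over lists of rows and
-- columns, and anticommuting contractions replace permutations and their signs.

-- Integers in a commutative ring, for the ring solver.

module IntegerCoefficients {c ℓ} (R : CommutativeRing c ℓ) where

  open CommutativeRing R
  open import Algebra.Properties.Ring ring
    using (-‿involutive; -‿anti-homo-+; -‿distribˡ-*; -‿distribʳ-*; -0#≈0#)
  open import Algebra.Properties.AbelianGroup +-abelianGroup using (xyx⁻¹≈y; ⁻¹-∙-comm)
  open import Algebra.Properties.Monoid.Mult +-monoid using (×-homo-+) renaming (_×_ to _·_)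
  open import Algebra.Properties.Semiring.Mult semiring using (×1-homo-*)
  open import Relation.Binary.Reasoning.Setoid setoid

  -- The clauses are those of `ι`, so on integers in constructor form both compute to the same
  -- element and solver identities fit the matrix entries as they stand.
  ⟦_⟧ : ℤ → Carrier
  ⟦ + n ⟧      = n · 1#
  ⟦ -[1+ n ] ⟧ = - (suc n · 1#)

  ⟦⟧-⊖ : ∀ m n → ⟦ m ℤ.⊖ n ⟧ ≈ m · 1# - n · 1#
  ⟦⟧-⊖ zero    zero    = sym (-‿inverseʳ 0#)
  ⟦⟧-⊖ (suc m) zero    = sym (trans (+-congˡ -0#≈0#) (+-identityʳ _))
  ⟦⟧-⊖ zero    (suc n) = sym (+-identityˡ _)
  ⟦⟧-⊖ (suc m) (suc n) = begin
    ⟦ suc m ℤ.⊖ suc n ⟧                      ≡⟨ ≡.cong ⟦_⟧ (ℤ.[1+m]⊖[1+n]≡m⊖n m n) ⟩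
    ⟦ m ℤ.⊖ n ⟧                              ≈⟨ ⟦⟧-⊖ m n ⟩
    m · 1# - n · 1#                        ≈⟨ +-congʳ (xyx⁻¹≈y 1# (m · 1#)) ⟨
    (1# + m · 1#) - 1# - n · 1#            ≈⟨ +-assoc _ _ _ ⟩
    (1# + m · 1#) + (- 1# - n · 1#)        ≈⟨ +-congˡ (⁻¹-∙-comm _ _) ⟩
    (1# + m · 1#) - (1# + n · 1#)          ∎

  ⟦⟧-+ : ∀ i j → ⟦ i ℤ.+ j ⟧ ≈ ⟦ i ⟧ + ⟦ j ⟧
  ⟦⟧-+ (+ m)      (+ n)      = ×-homo-+ 1# m n
  ⟦⟧-+ (+ m)      -[1+ n ]   = ⟦⟧-⊖ m (suc n)
  ⟦⟧-+ -[1+ m ]   (+ n)      = trans (⟦⟧-⊖ n (suc m)) (+-comm _ _)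
  ⟦⟧-+ -[1+ m ]   -[1+ n ]   = begin
    - (1# + (1# + (m ℕ.+ n) · 1#))       ≈⟨ -‿cong (+-congˡ (×-homo-+ 1# (suc m) n)) ⟩
    - (1# + ((1# + m · 1#) + n · 1#))    ≈⟨ -‿cong (+-congˡ (+-comm _ _)) ⟩
    - (1# + (n · 1# + (1# + m · 1#)))    ≈⟨ -‿cong (+-assoc _ _ _) ⟨
    - ((1# + n · 1#) + (1# + m · 1#))    ≈⟨ -‿anti-homo-+ _ _ ⟩
    - (1# + m · 1#) - (1# + n · 1#)      ∎

  ⟦⟧-neg : ∀ i → ⟦ ℤ.- i ⟧ ≈ - ⟦ i ⟧
  ⟦⟧-neg (+ zero)  = sym -0#≈0#
  ⟦⟧-neg (+ suc n) = refl
  ⟦⟧-neg -[1+ n ]  = sym (-‿involutive _)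

  ⟦⟧-+◃ : ∀ n → ⟦ Sign.+ ℤ.◃ n ⟧ ≈ n · 1#
  ⟦⟧-+◃ n = reflexive (≡.cong ⟦_⟧ (ℤ.+◃n≡+n n))

  ⟦⟧--◃ : ∀ n → ⟦ Sign.- ℤ.◃ n ⟧ ≈ - (n · 1#)
  ⟦⟧--◃ n = trans (reflexive (≡.cong ⟦_⟧ (ℤ.-◃n≡-n n))) (⟦⟧-neg (+ n))

  ⟦⟧-* : ∀ i j → ⟦ i ℤ.* j ⟧ ≈ ⟦ i ⟧ * ⟦ j ⟧
  ⟦⟧-* (+ m)    (+ n)    = trans (⟦⟧-+◃ (m ℕ.* n)) (×1-homo-* m n)
  ⟦⟧-* (+ m)    -[1+ n ] = trans (⟦⟧--◃ (m ℕ.* suc n))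
    (trans (-‿cong (×1-homo-* m (suc n))) (-‿distribʳ-* _ _))
  ⟦⟧-* -[1+ m ] (+ n)    = trans (⟦⟧--◃ (suc m ℕ.* n))
    (trans (-‿cong (×1-homo-* (suc m) n)) (-‿distribˡ-* _ _))
  ⟦⟧-* -[1+ m ] -[1+ n ] = trans (⟦⟧-+◃ (suc m ℕ.* suc n))
    (trans (×1-homo-* (suc m) (suc n)) (sym (trans (sym (-‿distribˡ-* _ _))
    (trans (-‿cong (sym (-‿distribʳ-* _ _))) (-‿involutive _)))))

  private
    morphism : ℤ-rawRing -Raw-AlmostCommutative⟶ fromCommutativeRing R
    morphism = record
      { ⟦_⟧    = ⟦_⟧
      ; +-homo = ⟦⟧-+
      ; *-homo = ⟦⟧-*
      ; -‿homo = ⟦⟧-neg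
      ; 0-homo = refl
      -- `⟦ + 1 ⟧` unfolds to `1# + 0#`, not to `1#`.
      ; 1-homo = +-identityʳ 1#
      }

    _≟?_ : ∀ i j → Maybe (⟦ i ⟧ ≈ ⟦ j ⟧)
    i ≟? j with i ℤ.≟ j
    ... | yes ≡.refl = just refl
    ... | no  _      = nothing

  open Algebra.Solver.Ring ℤ-rawRing (fromCommutativeRing R) morphism _≟?_ public
    using (solve; con; _:=_; _:+_; _:*_; _:-_; :-_; _:^_)

-- Determinants as iterated contractions.

module Determinants {c ℓ i} (R : CommutativeRing c ℓ) (I : Set i) where

  open CommutativeRing R
  open IntegerCoefficients R
  open import Algebra.Properties.Ring ring using (-‿involutive; -0#≈0#)
  open import Relation.Binary.Reasoning.Setoid setoid

  Row Form : Set _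
  Row  = I → Carrier
  Form = List I → Carrier

  -- The interior product: contract the first argument of an alternating form
  -- with r, i.e. expand along the row r.
  infixr 5 _⌟_
  _⌟_ : Row → Form → Form
  (r ⌟ f) []       = 0#
  (r ⌟ f) (c ∷ cs) = r c * f cs - (r ⌟ (λ cs′ → f (c ∷ cs′))) cs

  -- With no rows left the form vanishes on nonempty lists, and `_⌟_` vanishes at `[]`, so unequal
  -- numbers of rows and columns give zero and no lengths are tracked in the types.
  determinant : List Row → Form
  determinant []       []      = 1#
  determinant []       (_ ∷ _) = 0#
  determinant (r ∷ rs) cs      = (r ⌟ determinant rs) cs

  infix 4 _≐_
  _≐_ : Form → Form → Set _
  f ≐ g = ∀ cs → f cs ≈ g cs

  private
    variable
      r s : Row
      f g : Form

  ⌟-cong : ∀ r → f ≐ g → r ⌟ f ≐ r ⌟ g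
  ⌟-cong r f≐g []       = refl
  ⌟-cong r f≐g (c ∷ cs) =
    +-cong (*-congˡ (f≐g cs)) (-‿cong (⌟-cong r (λ cs′ → f≐g (c ∷ cs′)) cs))

  ⌟-zero : ∀ r → (λ _ → 0#) ≐ r ⌟ (λ _ → 0#)
  ⌟-zero r []       = refl
  ⌟-zero r (c ∷ cs) = begin
    0#                                  ≈⟨ solve 1 (λ a → con (+ 0) := a :* con (+ 0) :- con (+ 0)) refl (r c) ⟩
    r c * 0# - 0#                       ≈⟨ +-congˡ (-‿cong (⌟-zero r cs)) ⟩
    r c * 0# - (r ⌟ (λ _ → 0#)) cs      ∎

  ⌟-+ : ∀ r → r ⌟ (λ cs → f cs + g cs) ≐ λ cs → (r ⌟ f) cs + (r ⌟ g) cs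
  ⌟-+ r []       = sym (+-identityʳ 0#)
  ⌟-+ r (c ∷ cs) = trans (+-congˡ (-‿cong (⌟-+ r cs)))
    (solve 5 (λ a x y z w → a :* (x :+ y) :- (z :+ w) := (a :* x :- z) :+ (a :* y :- w))
      refl (r c) _ _ _ _)

  ⌟-neg : ∀ r → r ⌟ (λ cs → - f cs) ≐ λ cs → - (r ⌟ f) cs
  ⌟-neg r []       = sym -0#≈0#
  ⌟-neg r (c ∷ cs) = trans (+-congˡ (-‿cong (⌟-neg r cs)))
    (solve 3 (λ a x y → a :* (:- x) :- (:- y) := :- (a :* x :- y)) refl (r c) _ _)

  -- The form `λ cs → (s ⌟ f) (c ∷ cs)` unfolds to `s c` times a form minus another one; this shape
  -- arises whenever contractions are nested.
  ⌟-scale-sub : ∀ r a → r ⌟ (λ cs → a * f cs - g cs) ≐ λ cs → a * (r ⌟ f) cs - (r ⌟ g) cs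
  ⌟-scale-sub r a []       = solve 1 (λ a → con (+ 0) := a :* con (+ 0) :- con (+ 0)) refl a
  ⌟-scale-sub r a (c ∷ cs) = trans (+-congˡ (-‿cong (⌟-scale-sub r a cs)))
    (solve 6 (λ a b x y z w → b :* (a :* x :- y) :- (a :* z :- w) := a :* (b :* x :- z) :- (b :* y :- w))
      refl a (r c) _ _ _ _)

  ⌟-sub : ∀ r s → (λ c → r c - s c) ⌟ f ≐ λ cs → (r ⌟ f) cs - (s ⌟ f) cs
  ⌟-sub r s []       = sym (-‿inverseʳ 0#)
  ⌟-sub r s (c ∷ cs) = trans (+-congˡ (-‿cong (⌟-sub r s cs)))
    (solve 5 (λ a b x y z → (a :- b) :* x :- (y :- z) := (a :* x :- y) :- (b :* x :- z))
      refl (r c) (s c) _ _ _)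

  -- Both sides delete the same two positions in opposite orders, and deleting the left one first
  -- shifts the right one by a place. Hence `f` may be any function on lists.
  ⌟-anticomm : ∀ r s → r ⌟ s ⌟ f ≐ λ cs → - (s ⌟ r ⌟ f) cs
  ⌟-anticomm {f} r s []       = sym -0#≈0#
  ⌟-anticomm {f} r s (c ∷ cs) = begin
    r c * (s ⌟ f) cs - (r ⌟ (λ cs′ → (s ⌟ f) (c ∷ cs′))) cs
      ≈⟨ +-congˡ (-‿cong (⌟-scale-sub r (s c) cs)) ⟩
    r c * (s ⌟ f) cs - (s c * (r ⌟ f) cs - (r ⌟ s ⌟ f∷) cs)
      ≈⟨ +-congˡ (-‿cong (+-congˡ (-‿cong (⌟-anticomm r s cs)))) ⟩
    r c * (s ⌟ f) cs - (s c * (r ⌟ f) cs - - (s ⌟ r ⌟ f∷) cs)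
      ≈⟨ solve 3 (λ x y z → x :- (y :- (:- z)) := :- (y :- (x :- z))) refl _ _ _ ⟩
    - (s c * (r ⌟ f) cs - (r c * (s ⌟ f) cs - (s ⌟ r ⌟ f∷) cs))
      ≈⟨ -‿cong (+-congˡ (-‿cong (⌟-scale-sub s (r c) cs))) ⟨
    - (s c * (r ⌟ f) cs - (s ⌟ (λ cs′ → (r ⌟ f) (c ∷ cs′))) cs) ∎
    where
    f∷ : Form
    f∷ cs′ = f (c ∷ cs′)

  -- Anticommutation would only show that twice this value vanishes; the separate induction avoids
  -- division by two.
  ⌟-self : ∀ r → r ⌟ r ⌟ f ≐ λ _ → 0#
  ⌟-self r []       = refl
  ⌟-self {f} r (c ∷ cs) = begin
    r c * (r ⌟ f) cs - (r ⌟ (λ cs′ → (r ⌟ f) (c ∷ cs′))) cs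
      ≈⟨ +-congˡ (-‿cong (⌟-scale-sub r (r c) cs)) ⟩
    r c * (r ⌟ f) cs - (r c * (r ⌟ f) cs - (r ⌟ r ⌟ (λ cs′ → f (c ∷ cs′))) cs)
      ≈⟨ +-congˡ (-‿cong (+-congˡ (-‿cong (⌟-self r cs)))) ⟩
    r c * (r ⌟ f) cs - (r c * (r ⌟ f) cs - 0#)
      ≈⟨ solve 1 (λ x → x :- (x :- con (+ 0)) := con (+ 0)) refl _ ⟩
    0# ∎

  ⌟-zeroʳ : ∀ r → f ≐ (λ _ → 0#) → r ⌟ f ≐ λ _ → 0#
  ⌟-zeroʳ r f≐0 cs = trans (⌟-cong r f≐0 cs) (sym (⌟-zero r cs))

  signed : ℕ → Carrier → Carrier
  signed zero    x = x
  signed (suc n) x = - signed n x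

  signed-cong : ∀ n {x y} → x ≈ y → signed n x ≈ signed n y
  signed-cong zero    x≈y = x≈y
  signed-cong (suc n) x≈y = -‿cong (signed-cong n x≈y)

  signed-neg : ∀ n x → signed n (- x) ≈ - signed n x
  signed-neg zero    x = refl
  signed-neg (suc n) x = -‿cong (signed-neg n x)

  signed-cancel : ∀ {m n} → m ≡ n → ∀ x → signed m (signed n x) ≈ x
  signed-cancel {zero}  ≡.refl x = refl
  signed-cancel {suc n} ≡.refl x = begin
    - signed n (- signed n x)     ≈⟨ -‿cong (signed-neg n _) ⟩
    - - signed n (signed n x)     ≈⟨ -‿involutive _ ⟩
    signed n (signed n x)         ≈⟨ signed-cancel {n} ≡.refl x ⟩
    x                             ∎

  ⌟-signed : ∀ n r → r ⌟ (λ cs → signed n (f cs)) ≐ λ cs → signed n ((r ⌟ f) cs)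
  ⌟-signed zero    r cs = refl
  ⌟-signed (suc n) r cs = trans (⌟-neg r cs) (-‿cong (⌟-signed n r cs))

  ⌟-vanish : ∀ {cs} → All (λ c → r c ≈ 0#) cs → (r ⌟ f) cs ≈ 0#
  ⌟-vanish []                         = refl
  ⌟-vanish {r} {f} {c ∷ cs} (rc≈0 ∷ r≈0) = begin
    r c * f cs - (r ⌟ (λ cs′ → f (c ∷ cs′))) cs  ≈⟨ +-cong (*-congʳ rc≈0) (-‿cong (⌟-vanish r≈0)) ⟩
    0# * f cs - 0#                               ≈⟨ solve 1 (λ x → con (+ 0) :* x :- con (+ 0) := con (+ 0)) refl _ ⟩
    0#                                           ∎

  ⌟-skip : ∀ {xs} → All (λ c → r c ≈ 0#) xs → ∀ zs →
           (r ⌟ f) (xs ++ zs) ≈ signed (length xs) ((r ⌟ (λ cs → f (xs ++ cs))) zs)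
  ⌟-skip []                              zs = refl
  ⌟-skip {r} {f} {x ∷ xs} (rx≈0 ∷ r≈0) zs = begin
    r x * f (xs ++ zs) - (r ⌟ (λ cs → f (x ∷ cs))) (xs ++ zs)
      ≈⟨ +-cong (*-congʳ rx≈0) (-‿cong (⌟-skip r≈0 zs)) ⟩
    0# * f (xs ++ zs) - signed (length xs) ((r ⌟ (λ cs → f (x ∷ xs ++ cs))) zs)
      ≈⟨ solve 2 (λ a b → con (+ 0) :* a :- b := :- b) refl _ _ ⟩
    - signed (length xs) ((r ⌟ (λ cs → f (x ∷ xs ++ cs))) zs) ∎

  determinant-front : ∀ ps r rs →
    determinant (ps ++ r ∷ rs) ≐ λ cs → signed (length ps) ((r ⌟ determinant (ps ++ rs)) cs)
  determinant-front []       r rs cs = refl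
  determinant-front (p ∷ ps) r rs cs = begin
    (p ⌟ determinant (ps ++ r ∷ rs)) cs
      ≈⟨ ⌟-cong p (determinant-front ps r rs) cs ⟩
    (p ⌟ (λ cs′ → signed (length ps) ((r ⌟ determinant (ps ++ rs)) cs′))) cs
      ≈⟨ ⌟-signed (length ps) p cs ⟩
    signed (length ps) ((p ⌟ r ⌟ determinant (ps ++ rs)) cs)
      ≈⟨ signed-cong (length ps) (⌟-anticomm p r cs) ⟩
    signed (length ps) (- (r ⌟ p ⌟ determinant (ps ++ rs)) cs)
      ≈⟨ signed-neg (length ps) _ ⟩
    - signed (length ps) ((r ⌟ p ⌟ determinant (ps ++ rs)) cs) ∎

  -- Moved as a pair, two rows change the sign twice at each row of `ps`, so no sign remains.
  determinant-front₂ : ∀ ps r s rs → determinant (ps ++ r ∷ s ∷ rs) ≐ r ⌟ s ⌟ determinant (ps ++ rs)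
  determinant-front₂ []       r s rs cs = refl
  determinant-front₂ (p ∷ ps) r s rs cs = begin
    (p ⌟ determinant (ps ++ r ∷ s ∷ rs)) cs
      ≈⟨ ⌟-cong p (determinant-front₂ ps r s rs) cs ⟩
    (p ⌟ r ⌟ s ⌟ determinant (ps ++ rs)) cs
      ≈⟨ ⌟-anticomm p r cs ⟩
    - (r ⌟ p ⌟ s ⌟ determinant (ps ++ rs)) cs
      ≈⟨ ⌟-neg r cs ⟨
    (r ⌟ (λ cs′ → - (p ⌟ s ⌟ determinant (ps ++ rs)) cs′)) cs
      ≈⟨ ⌟-cong r (⌟-anticomm s p) cs ⟨
    (r ⌟ s ⌟ p ⌟ determinant (ps ++ rs)) cs ∎

  ⌟-repeated : ∀ ps r rs → r ⌟ determinant (ps ++ r ∷ rs) ≐ λ _ → 0#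
  ⌟-repeated ps r rs cs = begin
    (r ⌟ determinant (ps ++ r ∷ rs)) cs
      ≈⟨ ⌟-cong r (determinant-front ps r rs) cs ⟩
    (r ⌟ (λ cs′ → signed (length ps) ((r ⌟ determinant (ps ++ rs)) cs′))) cs
      ≈⟨ ⌟-signed (length ps) r cs ⟩
    signed (length ps) ((r ⌟ r ⌟ determinant (ps ++ rs)) cs)
      ≈⟨ signed-cong (length ps) (⌟-self r cs) ⟩
    signed (length ps) 0#
      ≈⟨ signed-0 (length ps) ⟩
    0# ∎
    where
    signed-0 : ∀ n → signed n 0# ≈ 0#
    signed-0 zero    = refl
    signed-0 (suc n) = trans (-‿cong (signed-0 n)) -0#≈0#

  -- The index type has no addition of its own, so "column `c` is the sum of `a` and `b`" can only
  -- be expressed through the values of a form.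
  Splits : I → I → I → Form → Set _
  Splits c a b f = ∀ xs ys → f (xs ++ c ∷ ys) ≈ f (xs ++ a ∷ ys) + f (xs ++ b ∷ ys)

  ⌟-splits : ∀ {c a b} → r c ≈ r a + r b → Splits c a b f → Splits c a b (r ⌟ f)
  ⌟-splits {r} {f} {c} {a} {b} rc f-splits [] ys = begin
    r c * f ys - (r ⌟ (λ cs → f (c ∷ cs))) ys
      ≈⟨ +-cong (*-congʳ rc) (-‿cong (trans (⌟-cong r (f-splits []) ys) (⌟-+ r ys))) ⟩
    (r a + r b) * f ys - ((r ⌟ (λ cs → f (a ∷ cs))) ys + (r ⌟ (λ cs → f (b ∷ cs))) ys)
      ≈⟨ solve 5 (λ a b x y z → (a :+ b) :* x :- (y :+ z) := (a :* x :- y) :+ (b :* x :- z)) refl _ _ _ _ _ ⟩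
    (r ⌟ f) (a ∷ ys) + (r ⌟ f) (b ∷ ys) ∎
  ⌟-splits rc f-splits (x ∷ xs) ys = trans
    (+-cong (*-congˡ (f-splits xs ys)) (-‿cong (⌟-splits rc (λ xs′ → f-splits (x ∷ xs′)) xs ys)))
    (solve 5 (λ a x y z w → a :* (x :+ y) :- (z :+ w) := (a :* x :- z) :+ (a :* y :- w)) refl _ _ _ _ _)

  -- Only the listed rows have to see `c` as a sum. This matters in the merges, where the relation
  -- can fail at a row that has already been expanded away.
  determinant-splits : ∀ {c a b rs} → All (λ r → r c ≈ r a + r b) rs → Splits c a b (determinant rs)
  determinant-splits []         []       ys = sym (+-identityʳ 0#)
  determinant-splits []         (_ ∷ xs) ys = sym (+-identityʳ 0#)
  determinant-splits (rc ∷ rcs) xs       ys = ⌟-splits rc (determinant-splits rcs) xs ys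

  Alternates : I → I → Form → Set _
  Alternates a b f = ∀ xs ys → f (xs ++ a ∷ b ∷ ys) ≈ - f (xs ++ b ∷ a ∷ ys)

  ⌟-alternates : ∀ {a b} → Alternates a b f → Alternates a b (r ⌟ f)
  ⌟-alternates {f} {r} {a} {b} f-alt [] ys = begin
    r a * f (b ∷ ys) - (r b * f (a ∷ ys) - (r ⌟ (λ cs → f (a ∷ b ∷ cs))) ys)
      ≈⟨ +-congˡ (-‿cong (+-congˡ (-‿cong (trans (⌟-cong r (f-alt []) ys) (⌟-neg r ys))))) ⟩
    r a * f (b ∷ ys) - (r b * f (a ∷ ys) - - (r ⌟ (λ cs → f (b ∷ a ∷ cs))) ys)
      ≈⟨ solve 3 (λ x y z → x :- (y :- (:- z)) := :- (y :- (x :- z))) refl _ _ _ ⟩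
    - (r ⌟ f) (b ∷ a ∷ ys) ∎
  ⌟-alternates f-alt (x ∷ xs) ys = trans
    (+-cong (*-congˡ (f-alt xs ys)) (-‿cong (⌟-alternates (λ xs′ → f-alt (x ∷ xs′)) xs ys)))
    (solve 3 (λ a x y → a :* (:- x) :- (:- y) := :- (a :* x :- y)) refl _ _ _)

  determinant-alternates : ∀ a b rs → Alternates a b (determinant rs)
  determinant-alternates a b []       []       ys = sym -0#≈0#
  determinant-alternates a b []       (_ ∷ xs) ys = sym -0#≈0#
  determinant-alternates a b (r ∷ rs) xs       ys = ⌟-alternates (determinant-alternates a b rs) xs ys

  -- This is the row operation: `r` may be subtracted once contraction with `r` kills the remaining
  -- form, as it does when `r` is one of the rows of that form.
  ⌟-replace : (r ⌟ f ≐ λ _ → 0#) → s ⌟ f ≐ (λ c → s c - r c) ⌟ f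
  ⌟-replace {r} {f} {s} rf≐0 cs = begin
    (s ⌟ f) cs                   ≈⟨ solve 1 (λ x → x := x :- con (+ 0)) refl _ ⟩
    (s ⌟ f) cs - 0#              ≈⟨ +-congˡ (-‿cong (rf≐0 cs)) ⟨
    (s ⌟ f) cs - (r ⌟ f) cs      ≈⟨ ⌟-sub s r cs ⟨
    ((λ c → s c - r c) ⌟ f) cs   ∎

  -- Subtracting row r₀ from r₁ and then adding column c₁ to c₀ leaves d as the
  -- only nonzero entry of row r₁.
  merge-twins : ∀ {d r₀ r₁ c₀ c₁ c} ps rs xs ys → length ps ≡ length xs →
    let q = λ z → r₁ z - r₀ z in
    All (λ z → q z ≈ 0#) xs → All (λ z → q z ≈ 0#) ys → q c₀ ≈ - d → q c₁ ≈ d →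
    All (λ r → r c ≈ r c₀ + r c₁) (ps ++ r₀ ∷ rs) →
    determinant (ps ++ r₀ ∷ r₁ ∷ rs) (xs ++ c₀ ∷ c₁ ∷ ys) ≈ d * determinant (ps ++ r₀ ∷ rs) (xs ++ c ∷ ys)
  merge-twins {d} {r₀} {r₁} {c₀} {c₁} {c} ps rs xs ys len qxs qys qc₀ qc₁ split = begin
    determinant (ps ++ r₀ ∷ r₁ ∷ rs) zs
      ≈⟨ swap-rows ps zs ⟩
    - determinant (ps ++ r₁ ∷ r₀ ∷ rs) zs
      ≈⟨ -‿cong (determinant-front ps r₁ (r₀ ∷ rs) zs) ⟩
    - signed n ((r₁ ⌟ G) zs)
      ≈⟨ -‿cong (signed-cong n (⌟-replace (⌟-repeated ps r₀ rs) zs)) ⟩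
    - signed n ((q ⌟ G) (xs ++ c₀ ∷ c₁ ∷ ys))
      ≈⟨ -‿cong (signed-cong n (⌟-skip qxs (c₀ ∷ c₁ ∷ ys))) ⟩
    - signed n (signed (length xs)
      (q c₀ * G (xs ++ c₁ ∷ ys) - (q c₁ * G (xs ++ c₀ ∷ ys) - (q ⌟ (λ cs → G (xs ++ c₀ ∷ c₁ ∷ cs))) ys)))
      ≈⟨ -‿cong (signed-cancel len _) ⟩
    - (q c₀ * G (xs ++ c₁ ∷ ys) - (q c₁ * G (xs ++ c₀ ∷ ys) - (q ⌟ (λ cs → G (xs ++ c₀ ∷ c₁ ∷ cs))) ys))
      ≈⟨ -‿cong (+-cong (*-congʳ qc₀) (-‿cong (+-cong (*-congʳ qc₁) (-‿cong (⌟-vanish qys))))) ⟩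
    - (- d * G (xs ++ c₁ ∷ ys) - (d * G (xs ++ c₀ ∷ ys) - 0#))
      ≈⟨ solve 3 (λ d x y → :- (:- d :* y :- (d :* x :- con (+ 0))) := d :* (x :+ y)) refl d _ _ ⟩
    d * (G (xs ++ c₀ ∷ ys) + G (xs ++ c₁ ∷ ys))
      ≈⟨ *-congˡ (determinant-splits split xs ys) ⟨
    d * G (xs ++ c ∷ ys) ∎
    where
    n = length ps
    zs = xs ++ c₀ ∷ c₁ ∷ ys
    G = determinant (ps ++ r₀ ∷ rs)

    q : Row
    q z = r₁ z - r₀ z

    swap-rows : ∀ ps → determinant (ps ++ r₀ ∷ r₁ ∷ rs) ≐ λ cs → - determinant (ps ++ r₁ ∷ r₀ ∷ rs) cs
    swap-rows []       cs = ⌟-anticomm r₀ r₁ cs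
    swap-rows (p ∷ ps) cs = trans (⌟-cong p (swap-rows ps) cs) (⌟-neg p cs)

  -- The subtracted rows form a strip `(-M | M)`, where `M` has rows `(α, β)` and `(γ, δ)`. Its 2 by
  -- 2 minors at `c₀, c₁` and at `d₀, d₁` vanish, and the other four are the determinant of `M` up
  -- to sign, so expansion leaves the four terms of a product of two column sums. Signs cancel
  -- because two rows move to the front and both then skip `xs`.
  merge-twin-pairs : ∀ {α β γ δ r₀ s₀ r₁ s₁ c₀ d₀ c₁ d₁ c d} ps rs xs ys →
    let q = λ z → r₁ z - r₀ z; t = λ z → s₁ z - s₀ z in
    All (λ z → q z ≈ 0#) xs → All (λ z → q z ≈ 0#) ys →
    All (λ z → t z ≈ 0#) xs → All (λ z → t z ≈ 0#) ys →
    q c₀ ≈ - α → q d₀ ≈ - β → q c₁ ≈ α → q d₁ ≈ β →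
    t c₀ ≈ - γ → t d₀ ≈ - δ → t c₁ ≈ γ → t d₁ ≈ δ →
    All (λ r → r c ≈ r c₀ + r c₁) (ps ++ r₀ ∷ s₀ ∷ rs) →
    All (λ r → r d ≈ r d₀ + r d₁) (ps ++ r₀ ∷ s₀ ∷ rs) →
    determinant (ps ++ r₀ ∷ s₀ ∷ r₁ ∷ s₁ ∷ rs) (xs ++ c₀ ∷ d₀ ∷ c₁ ∷ d₁ ∷ ys) ≈
    (α * δ - β * γ) * determinant (ps ++ r₀ ∷ s₀ ∷ rs) (xs ++ c ∷ d ∷ ys)
  merge-twin-pairs {α} {β} {γ} {δ} {r₀} {s₀} {r₁} {s₁} {c₀} {d₀} {c₁} {d₁} {c} {d} ps rs xs ys
    qxs qys txs tys qc₀ qd₀ qc₁ qd₁ tc₀ td₀ tc₁ td₁ c-split d-split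
    = begin
    determinant (ps ++ r₀ ∷ s₀ ∷ r₁ ∷ s₁ ∷ rs) zs
      ≡⟨ ≡.cong (λ rs′ → determinant rs′ zs) (++-assoc ps (r₀ ∷ s₀ ∷ []) (r₁ ∷ s₁ ∷ rs)) ⟨
    determinant ((ps ++ r₀ ∷ s₀ ∷ []) ++ r₁ ∷ s₁ ∷ rs) zs
      ≈⟨ determinant-front₂ (ps ++ r₀ ∷ s₀ ∷ []) r₁ s₁ rs zs ⟩
    (r₁ ⌟ s₁ ⌟ determinant ((ps ++ r₀ ∷ s₀ ∷ []) ++ rs)) zs
      ≡⟨ ≡.cong (λ rs′ → (r₁ ⌟ s₁ ⌟ determinant rs′) zs) (++-assoc ps (r₀ ∷ s₀ ∷ []) rs) ⟩
    (r₁ ⌟ s₁ ⌟ H) zs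
      ≈⟨ ⌟-cong r₁ (⌟-replace s₀H≐0) zs ⟩
    (r₁ ⌟ t ⌟ H) zs
      ≈⟨ ⌟-replace r₀tH≐0 zs ⟩
    (q ⌟ t ⌟ H) (xs ++ ws)
      ≈⟨ ⌟-skip {f = t ⌟ H} qxs ws ⟩
    signed m ((q ⌟ (λ cs → (t ⌟ H) (xs ++ cs))) ws)
      ≈⟨ signed-cong m (trans (⌟-cong q (⌟-skip {f = H} txs) ws) (⌟-signed {f = t ⌟ h} m q ws)) ⟩
    signed m (signed m ((q ⌟ t ⌟ h) ws))
      ≈⟨ signed-cancel {m} ≡.refl _ ⟩
    (q ⌟ t ⌟ h) ws
      ≈⟨ +-cong (*-cong qc₀ (three td₀ tc₁ td₁))
        (-‿cong (+-cong (*-cong qd₀ (three tc₀ tc₁ td₁))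
        (-‿cong (+-cong (*-cong qc₁ (three tc₀ td₀ td₁))
        (-‿cong (+-cong (*-cong qd₁ (three tc₀ td₀ tc₁))
        (-‿cong (⌟-vanish {f = λ cs → (t ⌟ h) (c₀ ∷ d₀ ∷ c₁ ∷ d₁ ∷ cs)} qys)))))))) ⟩
    - α * (- δ * h (c₁ ∷ d₁ ∷ ys) - (γ * h (d₀ ∷ d₁ ∷ ys) - δ * h (d₀ ∷ c₁ ∷ ys))) -
      (- β * (- γ * h (c₁ ∷ d₁ ∷ ys) - (γ * h (c₀ ∷ d₁ ∷ ys) - δ * h (c₀ ∷ c₁ ∷ ys))) -
      (α * (- γ * h (d₀ ∷ d₁ ∷ ys) - (- δ * h (c₀ ∷ d₁ ∷ ys) - δ * h (c₀ ∷ d₀ ∷ ys))) -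
      (β * (- γ * h (d₀ ∷ c₁ ∷ ys) - (- δ * h (c₀ ∷ c₁ ∷ ys) - γ * h (c₀ ∷ d₀ ∷ ys))) - 0#)))
      ≈⟨ solve 10 (λ α β γ δ c₁d₁ d₀d₁ d₀c₁ c₀d₁ c₀c₁ c₀d₀ →
           :- α :* (:- δ :* c₁d₁ :- (γ :* d₀d₁ :- δ :* d₀c₁)) :-
             (:- β :* (:- γ :* c₁d₁ :- (γ :* c₀d₁ :- δ :* c₀c₁)) :-
             (α :* (:- γ :* d₀d₁ :- (:- δ :* c₀d₁ :- δ :* c₀d₀)) :-
             (β :* (:- γ :* d₀c₁ :- (:- δ :* c₀c₁ :- γ :* c₀d₀)) :- con (+ 0))))
           := (α :* δ :- β :* γ) :* ((c₀d₀ :+ c₀d₁) :+ (:- d₀c₁ :+ c₁d₁)))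
         refl α β γ δ _ _ _ _ _ _ ⟩
    (α * δ - β * γ) * ((h (c₀ ∷ d₀ ∷ ys) + h (c₀ ∷ d₁ ∷ ys)) + (- h (d₀ ∷ c₁ ∷ ys) + h (c₁ ∷ d₁ ∷ ys)))
      -- Contraction keeps the remaining columns in list order, so the mixed term arrives as
      -- `d₀ ∷ c₁`; swapping it brings all four terms into the places of `c` and `d`.
      ≈⟨ *-congˡ (+-congˡ (+-congʳ (determinant-alternates c₁ d₀ (ps ++ r₀ ∷ s₀ ∷ rs) xs ys))) ⟨
    (α * δ - β * γ) * ((h (c₀ ∷ d₀ ∷ ys) + h (c₀ ∷ d₁ ∷ ys)) + (h (c₁ ∷ d₀ ∷ ys) + h (c₁ ∷ d₁ ∷ ys)))
      ≈⟨ *-congˡ (+-cong (split-d c₀) (split-d c₁)) ⟨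
    (α * δ - β * γ) * (h (c₀ ∷ d ∷ ys) + h (c₁ ∷ d ∷ ys))
      ≈⟨ *-congˡ (determinant-splits c-split xs (d ∷ ys)) ⟨
    (α * δ - β * γ) * h (c ∷ d ∷ ys) ∎
    where
    m  = length xs
    ws = c₀ ∷ d₀ ∷ c₁ ∷ d₁ ∷ ys
    zs = xs ++ ws

    q t : Row
    q z = r₁ z - r₀ z
    t z = s₁ z - s₀ z

    H h : Form
    H    = determinant (ps ++ r₀ ∷ s₀ ∷ rs)
    h cs = H (xs ++ cs)

    s₀H≐0 : s₀ ⌟ H ≐ λ _ → 0#
    s₀H≐0 cs = begin
      (s₀ ⌟ H) cs
        ≡⟨ ≡.cong (λ rs′ → (s₀ ⌟ determinant rs′) cs) (++-assoc ps (r₀ ∷ []) (s₀ ∷ rs)) ⟨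
      (s₀ ⌟ determinant ((ps ++ r₀ ∷ []) ++ s₀ ∷ rs)) cs
        ≈⟨ ⌟-repeated (ps ++ r₀ ∷ []) s₀ rs cs ⟩
      0# ∎

    r₀tH≐0 : r₀ ⌟ t ⌟ H ≐ λ _ → 0#
    r₀tH≐0 cs = begin
      (r₀ ⌟ t ⌟ H) cs    ≈⟨ ⌟-anticomm r₀ t cs ⟩
      - (t ⌟ r₀ ⌟ H) cs  ≈⟨ -‿cong (⌟-zeroʳ t (⌟-repeated ps r₀ (s₀ ∷ rs)) cs) ⟩
      - 0#               ≈⟨ -0#≈0# ⟩
      0#                 ∎

    three : ∀ {x y z x′ y′ z′} → t x ≈ x′ → t y ≈ y′ → t z ≈ z′ →
            (t ⌟ h) (x ∷ y ∷ z ∷ ys) ≈ x′ * h (y ∷ z ∷ ys) - (y′ * h (x ∷ z ∷ ys) - z′ * h (x ∷ y ∷ ys))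
    three tx ty tz = +-cong (*-congʳ tx) (-‿cong (+-cong (*-congʳ ty) (-‿cong
      (trans (+-cong (*-congʳ tz) (trans (-‿cong (⌟-vanish tys)) -0#≈0#)) (+-identityʳ _)))))

    split-d : ∀ x → h (x ∷ d ∷ ys) ≈ h (x ∷ d₀ ∷ ys) + h (x ∷ d₁ ∷ ys)
    split-d x = begin
      H (xs ++ x ∷ d ∷ ys)
        ≡⟨ ≡.cong H (++-assoc xs (x ∷ []) (d ∷ ys)) ⟨
      H ((xs ++ x ∷ []) ++ d ∷ ys)
        ≈⟨ determinant-splits d-split (xs ++ x ∷ []) ys ⟩
      H ((xs ++ x ∷ []) ++ d₀ ∷ ys) + H ((xs ++ x ∷ []) ++ d₁ ∷ ys)
        ≡⟨ ≡.cong₂ (λ a b → H a + H b) (++-assoc xs (x ∷ []) (d₀ ∷ ys)) (++-assoc xs (x ∷ []) (d₁ ∷ ys)) ⟩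
      H (xs ++ x ∷ d₀ ∷ ys) + H (xs ++ x ∷ d₁ ∷ ys) ∎

-- Entries of the identity, and pairwise distinctness in lists.

identity-refl : ∀ {n} (i : Fin n) → identity n i i ≡ + 1
identity-refl i with i ≟ i
... | yes _   = ≡.refl
... | no i≢i = contradiction ≡.refl i≢i

identity-≢ : ∀ {n} {i j : Fin n} → i ≢ j → identity n i j ≡ + 0
identity-≢ {i = i} {j} i≢j with i ≟ j
... | yes i≡j = contradiction i≡j i≢j
... | no _    = ≡.refl

module _ {a r} {A : Set a} {R : A → A → Set r} where

  AllPairs-middle₂ : ∀ xs {y z zs} → AllPairs R (xs ++ y ∷ z ∷ zs) →
    All (λ x → R x y × R x z) xs × R y z × All (λ x → R y x × R z x) zs
  AllPairs-middle₂ []       ((yz ∷ yzs) ∷ zzs ∷ _) = [] , yz , All.zip (yzs , zzs)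
  AllPairs-middle₂ (x ∷ xs) (xR ∷ rest) with All.++⁻ʳ xs xR | AllPairs-middle₂ xs rest
  ... | xy ∷ xz ∷ _ | xsR , yz , zsR = (xy , xz) ∷ xsR , yz , zsR

  AllPairs-merge : ∀ xs {y z y′ zs} → (∀ {x} → R x y → R x y′) → (∀ {x} → R y x → R y′ x) →
    AllPairs R (xs ++ y ∷ z ∷ zs) → AllPairs R (xs ++ y′ ∷ zs)
  AllPairs-merge []       xy yx ((_ ∷ yzs) ∷ _ ∷ zzs) = All.map yx yzs ∷ zzs
  AllPairs-merge (x ∷ xs) xy yx (xR ∷ rest) with All.++⁻ xs xR
  ... | xxs , xRy ∷ _ ∷ xzs = All.++⁺ xxs (xy xRy ∷ xzs) ∷ AllPairs-merge xs xy yx rest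

-- Weighted columns and their merging.

-- Vertices are pairs (i , j) of a block and a position in the block, position
-- zero being the one on the core hyperedge; the centre is a block of its own.
-- A column ((i , j) , a , b) stands for a merged column: a weighs the part π of
-- its entries that depends on being in the same block, b the part ε that depends
-- on positions only. An off-diagonal entry of - S is δ i i′ * π j j′ + ε j j′.
module WeightedSeidel {r ℓ} (R : CommutativeRing r ℓ) (n l : ℕ) (d : CommutativeRing.Carrier R) where

  open CommutativeRing R hiding (zero)
  open IntegerCoefficients R
  open import Algebra.Properties.Semiring.Exp semiring using (_^_)
  open import Relation.Binary.Reasoning.Setoid setoid

  Label Column : Set _
  Label  = Fin n × Fin (suc l)
  Column = Label × Carrier × Carrier

  open Determinants R Column

  δ : ∀ {n} → Fin n → Fin n → Carrier
  δ i j = ⟦ identity _ i j ⟧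

  π ε : Fin (suc l) → Fin (suc l) → Carrier
  π zero zero = ⟦ + 0 ⟧
  π _    _    = ⟦ + 2 ⟧
  ε zero zero = ⟦ + 1 ⟧
  ε _    _    = ⟦ -[1+ 0 ] ⟧

  entry : Label → Row
  entry (i , j) ((i′ , j′) , a , b) = δ i i′ * (δ j j′ * d + a * π j j′) + b * ε j j′

  row : Column → Row
  row = entry ∘ proj₁

  -- Weights occur on the column side only: a merge adds columns but keeps one of the rows as it is.
  -- The matrix therefore loses its symmetry, and a row is determined by a label alone.
  columnDet : List Column → Carrier
  columnDet cs = determinant (map row cs) cs

  δ-refl : ∀ {n} (i : Fin n) → δ i i ≈ ⟦ + 1 ⟧
  δ-refl i = reflexive (≡.cong ⟦_⟧ (identity-refl i))

  δ-≢ : ∀ {n} {i j : Fin n} → i ≢ j → δ i j ≈ ⟦ + 0 ⟧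
  δ-≢ i≢j = reflexive (≡.cong ⟦_⟧ (identity-≢ i≢j))

  δδ-≢ : ∀ {i i′ : Fin n} {j j′ : Fin (suc l)} → (i , j) ≢ (i′ , j′) → δ i i′ * δ j j′ ≈ ⟦ + 0 ⟧
  δδ-≢ {i} {i′} {j} {j′} u≢v with i ≟ i′
  ... | no  _      = zeroˡ _
  ... | yes ≡.refl = trans (*-congˡ (δ-≢ (λ j≡j′ → u≢v (≡.cong (i ,_) j≡j′)))) (zeroʳ _)

  entry-cong : ∀ u (c : Column) {x y} → δ (proj₁ u) (proj₁ (proj₁ c)) ≈ x → δ (proj₂ u) (proj₂ (proj₁ c)) ≈ y →
    entry u c ≈ x * (y * d + proj₁ (proj₂ c) * π (proj₂ u) (proj₂ (proj₁ c))) +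
                proj₂ (proj₂ c) * ε (proj₂ u) (proj₂ (proj₁ c))
  entry-cong u c δ₁ δ₂ = +-congʳ (*-cong δ₁ (+-congʳ (*-congʳ δ₂)))

  Distinct : List Column → Set _
  Distinct = AllPairs (_≢_ on proj₁)

  infix 4 _⟶[_]_
  -- Distinctness of labels is the invariant that a leaf merge consumes and hands on; bundling it
  -- with the equation lets the merges compose.
  _⟶[_]_ : List Column → Carrier → List Column → Set _
  cs ⟶[ x ] cs′ = Distinct cs → Distinct cs′ × columnDet cs ≈ x * columnDet cs′

  module _ {i : Fin n} {j j′ : Fin l} {a a′ b b′ : Carrier} where

    private
      u u′ : Label
      u  = i , suc j
      u′ = i , suc j′

    -- Two leaves of one petal have equal `π` and `ε` parts, so their rows differ only in the `d`
    -- terms at their own two columns.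
    merge-leaves : ∀ ps qs →
      ps ++ (u , a , b) ∷ (u′ , a′ , b′) ∷ qs ⟶[ d ] ps ++ (u , a + a′ , b + b′) ∷ qs
    merge-leaves ps qs distinct with AllPairs-middle₂ ps distinct
    ... | ps≢ , u≢u′ , qs≢ = AllPairs-merge ps (λ ≢ → ≢) (λ ≢ → ≢) distinct , (begin
      columnDet (ps ++ c₀ ∷ c₁ ∷ qs)
        ≡⟨ ≡.cong (λ rs → determinant rs (ps ++ c₀ ∷ c₁ ∷ qs)) (map-++ row ps _) ⟩
      determinant (map row ps ++ row c₀ ∷ row c₁ ∷ map row qs) (ps ++ c₀ ∷ c₁ ∷ qs)
        ≈⟨ merge-twins (map row ps) (map row qs) ps qs (length-map row ps)
             (All.map (λ (≢u , ≢u′) → difference-≢ (≢-sym ≢u) (≢-sym ≢u′)) ps≢)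
             (All.map (λ (≢u , ≢u′) → difference-≢ ≢u ≢u′) qs≢)
             difference₀ difference₁
             (All.++⁺ (All.map⁺ (All.map (λ (_ , ≢u′) → additive ≢u′) ps≢))
                      (additive u≢u′ ∷ All.map⁺ (All.map (λ (_ , u′≢) → additive (≢-sym u′≢)) qs≢))) ⟩
      d * determinant (map row ps ++ row c₀₁ ∷ map row qs) (ps ++ c₀₁ ∷ qs)
        ≡⟨ ≡.cong (λ rs → d * determinant rs (ps ++ c₀₁ ∷ qs)) (map-++ row ps _) ⟨
      d * columnDet (ps ++ c₀₁ ∷ qs) ∎)
      where
      c₀ c₁ c₀₁ : Column
      c₀ = u , a , b
      c₁ = u′ , a′ , b′
      c₀₁ = u , a + a′ , b + b′

      difference : ∀ v a b → entry u′ (v , a , b) - entry u (v , a , b) ≈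
                   (δ i (proj₁ v) * δ (suc j′) (proj₂ v) - δ i (proj₁ v) * δ (suc j) (proj₂ v)) * d
      -- At a leaf row `π` and `ε` compute to 2 and -1 for every column position, so these parts
      -- cancel.
      difference (i′ , k) a b = solve 7
        (λ x y z w d p q → (x :* (y :* d :+ p) :+ q) :- (x :* (z :* d :+ p) :+ q) := (x :* y :- x :* z) :* d)
        refl (δ i i′) (δ (suc j′) k) (δ (suc j) k) (δ (suc j) k) d (a * ⟦ + 2 ⟧) (b * ⟦ -[1+ 0 ] ⟧)

      difference-≢ : ∀ {v a b} → u ≢ v → u′ ≢ v → entry u′ (v , a , b) - entry u (v , a , b) ≈ 0#
      difference-≢ {v} {a} {b} u≢v u′≢v = begin
        entry u′ (v , a , b) - entry u (v , a , b)
          ≈⟨ difference v a b ⟩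
        _
          ≈⟨ *-congʳ (+-cong (δδ-≢ u′≢v) (-‿cong (δδ-≢ u≢v))) ⟩
        (⟦ + 0 ⟧ - ⟦ + 0 ⟧) * d
          ≈⟨ solve 1 (λ d → (con (+ 0) :- con (+ 0)) :* d := con (+ 0)) refl d ⟩
        0# ∎

      difference₀ : entry u′ c₀ - entry u c₀ ≈ - d
      difference₀ = begin
        entry u′ c₀ - entry u c₀
          ≈⟨ difference u a b ⟩
        _
          ≈⟨ *-congʳ (+-cong (δδ-≢ (≢-sym u≢u′)) (-‿cong (*-cong (δ-refl i) (δ-refl (suc j))))) ⟩
        (⟦ + 0 ⟧ - ⟦ + 1 ⟧ * ⟦ + 1 ⟧) * d
          ≈⟨ solve 1 (λ d → (con (+ 0) :- con (+ 1) :* con (+ 1)) :* d := :- d) refl d ⟩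
        - d ∎

      difference₁ : entry u′ c₁ - entry u c₁ ≈ d
      difference₁ = begin
        entry u′ c₁ - entry u c₁
          ≈⟨ difference u′ a′ b′ ⟩
        _
          ≈⟨ *-congʳ (+-cong (*-cong (δ-refl i) (δ-refl (suc j′))) (-‿cong (δδ-≢ u≢u′))) ⟩
        (⟦ + 1 ⟧ * ⟦ + 1 ⟧ - ⟦ + 0 ⟧) * d
          ≈⟨ solve 1 (λ d → (con (+ 1) :* con (+ 1) :- con (+ 0)) :* d := d) refl d ⟩
        d ∎

      additive : ∀ {v} → v ≢ u′ → entry v c₀₁ ≈ entry v c₀ + entry v c₁
      additive {i₁ , k} v≢u′ = begin
        δ i₁ i * (δ k (suc j) * d + (a + a′) * π k (suc j)) + (b + b′) * ε k (suc j)
          -- The column of `u′` carries a `d` term that the merged column lacks. It is subtracted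
          -- here and vanishes because `v` is not `u′`.
          ≈⟨ solve 10 (λ x y z d a a′ b b′ p e →
               x :* (y :* d :+ (a :+ a′) :* p) :+ (b :+ b′) :* e :=
               (x :* (y :* d :+ a :* p) :+ b :* e) :+ (x :* (z :* d :+ a′ :* p) :+ b′ :* e) :- x :* z :* d)
             refl (δ i₁ i) (δ k (suc j)) (δ k (suc j′)) d a a′ b b′ (π k (suc j)) (ε k (suc j)) ⟩
        entry v c₀ + (δ i₁ i * (δ k (suc j′) * d + a′ * π k (suc j)) + b′ * ε k (suc j)) - δ i₁ i * δ k (suc j′) * d
          ≈⟨ +-cong (+-congˡ (reflexive (≡.cong₂ (λ p e → δ i₁ i * (δ k (suc j′) * d + a′ * p) + b′ * e)
                                                 (π-leaf k) (ε-leaf k))))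
                    (-‿cong (*-congʳ (δδ-≢ v≢u′))) ⟩
        entry v c₀ + entry v c₁ - ⟦ + 0 ⟧ * d
          ≈⟨ solve 2 (λ x d → x :- con (+ 0) :* d := x) refl _ d ⟩
        entry v c₀ + entry v c₁ ∎
        where
        v = i₁ , k

        -- The matching inspects the row position first, so in a leaf column nothing reduces until
        -- `k` is split.
        π-leaf : ∀ k → π k (suc j) ≡ π k (suc j′)
        π-leaf zero    = ≡.refl
        π-leaf (suc _) = ≡.refl

        ε-leaf : ∀ k → ε k (suc j) ≡ ε k (suc j′)
        ε-leaf zero    = ≡.refl
        ε-leaf (suc _) = ≡.refl

  -- y plus n copies of x, in the form in which n successive merges produce it.
  add : ℕ → Carrier → Carrier → Carrier
  add zero    x y = y
  add (suc n) x y = add n x (y + x)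

  leaf : Fin n → Fin l → Column
  leaf i j = (i , suc j) , ⟦ + 1 ⟧ , ⟦ + 1 ⟧

  ⟶-refl : ∀ {cs} → cs ⟶[ 1# ] cs
  ⟶-refl distinct = distinct , sym (*-identityˡ _)

  ⟶-trans : ∀ {cs cs′ cs″ x y} → cs ⟶[ x ] cs′ → cs′ ⟶[ y ] cs″ → cs ⟶[ x * y ] cs″
  ⟶-trans p q distinct with p distinct
  ... | distinct′ , eq with q distinct′
  ... | distinct″ , eq′ = distinct″ , trans eq (trans (*-congˡ eq′) (sym (*-assoc _ _ _)))

  collapse-leaves : ∀ ps {i j a b} js qs →
    ps ++ ((i , suc j) , a , b) ∷ map (leaf i) js ++ qs ⟶[ d ^ length js ]
    ps ++ ((i , suc j) , add (length js) ⟦ + 1 ⟧ a , add (length js) ⟦ + 1 ⟧ b) ∷ qs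
  collapse-leaves ps []       qs = ⟶-refl
  collapse-leaves ps (j ∷ js) qs = ⟶-trans (merge-leaves ps (map (leaf _) js ++ qs)) (collapse-leaves ps js qs)

  module _ (j : Fin l) (js : List (Fin l)) where

    private
      w = add (length js) ⟦ + 1 ⟧ ⟦ + 1 ⟧

    -- Splitting off `j` puts the heavy leaf at the same position in every petal, with the same
    -- weight, which makes collapsed petals twins of each other. The length of `js` is the number of
    -- merges in a petal.
    block collapsed : Fin n → List Column
    block i     = ((i , zero) , ⟦ + 1 ⟧ , ⟦ + 1 ⟧) ∷ leaf i j ∷ map (leaf i) js
    collapsed i = ((i , zero) , ⟦ + 1 ⟧ , ⟦ + 1 ⟧) ∷ ((i , suc j) , w , w) ∷ []

    collapse-blocks : ∀ ps is →
      ps ++ concatMap block is ⟶[ (d ^ length js) ^ length is ] ps ++ concatMap collapsed is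
    collapse-blocks ps []       = ⟶-refl
    collapse-blocks ps (i ∷ is) = ⟶-trans step₁ step₂
      where
      core = (i , zero) , ⟦ + 1 ⟧ , ⟦ + 1 ⟧

      step₁ : ps ++ block i ++ concatMap block is ⟶[ d ^ length js ] ps ++ collapsed i ++ concatMap block is
      step₁ = ≡.subst₂ _⟶[ d ^ length js ]_
        (++-assoc ps (core ∷ []) _) (++-assoc ps (core ∷ []) _)
        (collapse-leaves (ps ++ core ∷ []) js (concatMap block is))

      step₂ : ps ++ collapsed i ++ concatMap block is ⟶[ (d ^ length js) ^ length is ]
              ps ++ collapsed i ++ concatMap collapsed is
      step₂ = ≡.subst₂ _⟶[ (d ^ length js) ^ length is ]_
        (++-assoc ps (collapsed i) _) (++-assoc ps (collapsed i) _)
        (collapse-blocks (ps ++ collapsed i) is)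

  -- This is the part of `entry` multiplied by `δ i i′`. The `ε` part does not depend on the block
  -- of the row and disappears when rows of two blocks are subtracted.
  blockEntry : Fin (suc l) → Fin (suc l) → Carrier → Carrier
  blockEntry k k′ a = δ k k′ * d + a * π k k′

  blockDet : Fin (suc l) → Fin (suc l) → Carrier → Carrier → Carrier
  blockDet k k′ a a′ = blockEntry k k a * blockEntry k′ k′ a′ - blockEntry k k′ a′ * blockEntry k′ k a

  module _ {i i₂ : Fin n} (i≢i₂ : i ≢ i₂) where

    Outside : Column → Set
    Outside ((i′ , _) , _) = i ≢ i′ × i₂ ≢ i′

    private
      difference : ∀ k k′ i′ a b → entry (i₂ , k) ((i′ , k′) , a , b) - entry (i , k) ((i′ , k′) , a , b) ≈
                   (δ i₂ i′ - δ i i′) * blockEntry k k′ a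
      difference k k′ i′ a b = solve 4 (λ x y p q → (x :* p :+ q) :- (y :* p :+ q) := (x :- y) :* p)
        refl (δ i₂ i′) (δ i i′) (blockEntry k k′ a) (b * ε k k′)

      outside : ∀ k {c} → Outside c → entry (i₂ , k) c - entry (i , k) c ≈ 0#
      outside k {(i′ , k′) , a , b} (i≢ , i₂≢) = begin
        _ ≈⟨ difference k k′ i′ a b ⟩
        (δ i₂ i′ - δ i i′) * blockEntry k k′ a ≈⟨ *-congʳ (+-cong (δ-≢ i₂≢) (-‿cong (δ-≢ i≢))) ⟩
        (⟦ + 0 ⟧ - ⟦ + 0 ⟧) * blockEntry k k′ a
          ≈⟨ solve 1 (λ p → (con (+ 0) :- con (+ 0)) :* p := con (+ 0)) refl _ ⟩
        0# ∎

      at-i : ∀ k k′ a b → entry (i₂ , k) ((i , k′) , a , b) - entry (i , k) ((i , k′) , a , b) ≈ - blockEntry k k′ a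
      at-i k k′ a b = begin
        _ ≈⟨ difference k k′ i a b ⟩
        (δ i₂ i - δ i i) * blockEntry k k′ a ≈⟨ *-congʳ (+-cong (δ-≢ (≢-sym i≢i₂)) (-‿cong (δ-refl i))) ⟩
        (⟦ + 0 ⟧ - ⟦ + 1 ⟧) * blockEntry k k′ a
          ≈⟨ solve 1 (λ p → (con (+ 0) :- con (+ 1)) :* p := :- p) refl _ ⟩
        - blockEntry k k′ a ∎

      at-i₂ : ∀ k k′ a b → entry (i₂ , k) ((i₂ , k′) , a , b) - entry (i , k) ((i₂ , k′) , a , b) ≈ blockEntry k k′ a
      at-i₂ k k′ a b = begin
        _ ≈⟨ difference k k′ i₂ a b ⟩
        (δ i₂ i₂ - δ i i₂) * blockEntry k k′ a ≈⟨ *-congʳ (+-cong (δ-refl i₂) (-‿cong (δ-≢ i≢i₂))) ⟩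
        (⟦ + 1 ⟧ - ⟦ + 0 ⟧) * blockEntry k k′ a
          ≈⟨ solve 1 (λ p → (con (+ 1) :- con (+ 0)) :* p := p) refl _ ⟩
        blockEntry k k′ a ∎

      -- Only the `ε` weights add up: a row outside block `i₂` does not see the `π` part of the
      -- removed column, and what a row of block `i` sees of its own block stays the same.
      additive : ∀ k {a b b₂ i′} k′ → i₂ ≢ i′ →
        entry (i′ , k′) ((i , k) , a , b + b₂) ≈
        entry (i′ , k′) ((i , k) , a , b) + entry (i′ , k′) ((i₂ , k) , a , b₂)
      additive k {a} {b} {b₂} {i′} k′ i₂≢i′ = begin
        δ i′ i * p + (b + b₂) * e
          ≈⟨ solve 5 (λ x p b b₂ e → x :* p :+ (b :+ b₂) :* e := (x :* p :+ b :* e) :+ (con (+ 0) :* p :+ b₂ :* e))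
               refl (δ i′ i) p b b₂ e ⟩
        (δ i′ i * p + b * e) + (⟦ + 0 ⟧ * p + b₂ * e)
          ≈⟨ +-congˡ (+-congʳ (*-congʳ (δ-≢ (≢-sym i₂≢i′)))) ⟨
        (δ i′ i * p + b * e) + (δ i′ i₂ * p + b₂ * e) ∎
        where
        p = blockEntry k′ k a
        e = ε k′ k

    -- The `ε` weights of the two blocks may differ, since the surviving block has absorbed others
    -- before. The `π` weights agree and never change, so each merge costs the same factor.
    merge-blocks : ∀ {k k′ a a′ b b′ b₂ b₂′} ps qs → All Outside ps → All Outside qs →
      columnDet (ps ++ ((i , k) , a , b) ∷ ((i , k′) , a′ , b′) ∷
                 ((i₂ , k) , a , b₂) ∷ ((i₂ , k′) , a′ , b₂′) ∷ qs) ≈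
      blockDet k k′ a a′ * columnDet (ps ++ ((i , k) , a , b + b₂) ∷ ((i , k′) , a′ , b′ + b₂′) ∷ qs)
    merge-blocks {k} {k′} {a} {a′} {b} {b′} {b₂} {b₂′} ps qs outer-ps outer-qs = begin
      columnDet (ps ++ c₀ ∷ d₀ ∷ c₁ ∷ d₁ ∷ qs)
        ≡⟨ ≡.cong (λ rs → determinant rs (ps ++ c₀ ∷ d₀ ∷ c₁ ∷ d₁ ∷ qs)) (map-++ row ps _) ⟩
      determinant (map row ps ++ row c₀ ∷ row d₀ ∷ row c₁ ∷ row d₁ ∷ map row qs) (ps ++ c₀ ∷ d₀ ∷ c₁ ∷ d₁ ∷ qs)
        ≈⟨ merge-twin-pairs (map row ps) (map row qs) ps qs
             (All.map (outside k) outer-ps) (All.map (outside k) outer-qs)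
             (All.map (outside k′) outer-ps) (All.map (outside k′) outer-qs)
             (at-i k k a b) (at-i k k′ a′ b′) (at-i₂ k k a b₂) (at-i₂ k k′ a′ b₂′)
             (at-i k′ k a b) (at-i k′ k′ a′ b′) (at-i₂ k′ k a b₂) (at-i₂ k′ k′ a′ b₂′)
             (remaining (additive k)) (remaining (additive k′)) ⟩
      blockDet k k′ a a′ * determinant (map row ps ++ row c₀ ∷ row d₀ ∷ map row qs) (ps ++ c₀₁ ∷ d₀₁ ∷ qs)
        ≡⟨ ≡.cong (λ rs → blockDet k k′ a a′ * determinant rs (ps ++ c₀₁ ∷ d₀₁ ∷ qs)) (map-++ row ps _) ⟨
      blockDet k k′ a a′ * columnDet (ps ++ c₀₁ ∷ d₀₁ ∷ qs) ∎
      where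
      c₀ d₀ c₁ d₁ c₀₁ d₀₁ : Column
      c₀  = (i , k) , a , b
      d₀  = (i , k′) , a′ , b′
      c₁  = (i₂ , k) , a , b₂
      d₁  = (i₂ , k′) , a′ , b₂′
      c₀₁ = (i , k) , a , b + b₂
      d₀₁ = (i , k′) , a′ , b′ + b₂′

      remaining : ∀ {p} {P : Row → Set p} → (∀ {i′} k″ → i₂ ≢ i′ → P (entry (i′ , k″))) →
                  All P (map row ps ++ row c₀ ∷ row d₀ ∷ map row qs)
      remaining P = All.++⁺ (All.map⁺ (All.map (λ {c} (_ , i₂≢) → P (proj₂ (proj₁ c)) i₂≢) outer-ps))
        (P k (≢-sym i≢i₂) ∷ P k′ (≢-sym i≢i₂) ∷
         All.map⁺ (All.map (λ {c} (_ , i₂≢) → P (proj₂ (proj₁ c)) i₂≢) outer-qs))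

  module _ {k k′ : Fin (suc l)} {a a′ β β′ : Carrier} where

    pair : Fin n → List Column
    pair i = ((i , k) , a , β) ∷ ((i , k′) , a′ , β′) ∷ []

    collapse-pairs : ∀ {c i b b′} is → Unique (proj₁ (proj₁ c) ∷ i ∷ is) →
      columnDet (c ∷ ((i , k) , a , b) ∷ ((i , k′) , a′ , b′) ∷ concatMap pair is) ≈
      blockDet k k′ a a′ ^ length is *
      columnDet (c ∷ ((i , k) , a , add (length is) β b) ∷ ((i , k′) , a′ , add (length is) β′ b′) ∷ [])
    collapse-pairs []        _ = sym (*-identityˡ _)
    collapse-pairs {c} {i} {b} {b′} (i₂ ∷ is) ((h≢i ∷ h≢i₂ ∷ h≢is) ∷ (i≢i₂ ∷ i≢is) ∷ i₂≢is ∷ is-unique) = begin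
      columnDet (c ∷ ((i , k) , a , b) ∷ ((i , k′) , a′ , b′) ∷ concatMap pair (i₂ ∷ is))
        ≈⟨ merge-blocks i≢i₂ (c ∷ []) (concatMap pair is) ((≢-sym h≢i , ≢-sym h≢i₂) ∷ []) (outer i≢is i₂≢is) ⟩
      blockDet k k′ a a′ * columnDet (c ∷ ((i , k) , a , b + β) ∷ ((i , k′) , a′ , b′ + β′) ∷ concatMap pair is)
        ≈⟨ *-congˡ (collapse-pairs is ((h≢i ∷ h≢is) ∷ i≢is ∷ is-unique)) ⟩
      blockDet k k′ a a′ * (blockDet k k′ a a′ ^ length is * _)
        ≈⟨ *-assoc _ _ _ ⟨
      blockDet k k′ a a′ ^ suc (length is) * _ ∎
      where
      outer : ∀ {is} → All (i ≢_) is → All (i₂ ≢_) is → All (Outside i≢i₂) (concatMap pair is)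
      outer []           []             = []
      outer (i≢ ∷ i≢s) (i₂≢ ∷ i₂≢s) = (i≢ , i₂≢) ∷ (i≢ , i₂≢) ∷ outer i≢s i₂≢s

  determinant₃ : ∀ (r₁ r₂ r₃ : Row) c₁ c₂ c₃ {a₁ a₂ a₃ b₁ b₂ b₃ e₁ e₂ e₃} →
    r₁ c₁ ≈ a₁ → r₁ c₂ ≈ a₂ → r₁ c₃ ≈ a₃ →
    r₂ c₁ ≈ b₁ → r₂ c₂ ≈ b₂ → r₂ c₃ ≈ b₃ →
    r₃ c₁ ≈ e₁ → r₃ c₂ ≈ e₂ → r₃ c₃ ≈ e₃ →
    determinant (r₁ ∷ r₂ ∷ r₃ ∷ []) (c₁ ∷ c₂ ∷ c₃ ∷ []) ≈
    a₁ * (b₂ * e₃ - b₃ * e₂) - a₂ * (b₁ * e₃ - b₃ * e₁) + a₃ * (b₁ * e₂ - b₂ * e₁)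
  determinant₃ r₁ r₂ r₃ c₁ c₂ c₃ a₁ a₂ a₃ b₁ b₂ b₃ e₁ e₂ e₃ = trans
    -- The empty determinant is `1#`, which is not the solver constant `⟦ + 1 ⟧`, so it enters as
    -- the variable `one` and is removed afterwards.
    (solve 10 (λ a₁ a₂ a₃ b₁ b₂ b₃ e₁ e₂ e₃ one →
      a₁ :* (b₂ :* (e₃ :* one :- con (+ 0)) :- (b₃ :* (e₂ :* one :- con (+ 0)) :- con (+ 0))) :-
      (a₂ :* (b₁ :* (e₃ :* one :- con (+ 0)) :- (b₃ :* (e₁ :* one :- con (+ 0)) :- con (+ 0))) :-
      (a₃ :* (b₁ :* (e₂ :* one :- con (+ 0)) :- (b₂ :* (e₁ :* one :- con (+ 0)) :- con (+ 0))) :- con (+ 0)))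
      := (a₁ :* (b₂ :* e₃ :- b₃ :* e₂) :- a₂ :* (b₁ :* e₃ :- b₃ :* e₁) :+ a₃ :* (b₁ :* e₂ :- b₂ :* e₁)) :* one)
      refl (r₁ c₁) (r₁ c₂) (r₁ c₃) (r₂ c₁) (r₂ c₂) (r₂ c₃) (r₃ c₁) (r₃ c₂) (r₃ c₃) 1#)
    (trans (*-identityʳ _)
    (+-cong (+-cong (*-cong a₁ (minor b₂ b₃ e₂ e₃)) (-‿cong (*-cong a₂ (minor b₁ b₃ e₁ e₃))))
            (*-cong a₃ (minor b₁ b₂ e₁ e₂))))
    where
    minor : ∀ {b c e f b′ c′ e′ f′} → b ≈ b′ → c ≈ c′ → e ≈ e′ → f ≈ f′ → b * f - c * e ≈ b′ * f′ - c′ * e′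
    minor b c e f = +-cong (*-cong b f) (-‿cong (*-cong c e))

  -- The expanded determinant with rows `(d + 1, p, - q)`, `(1, d + p, 2 * w - q)` and
  -- `(-1, 2 - p, d + 2 * w - q)`, for centre, core and leaf. Here `p` and `q` are the total `ε`
  -- weights of all core vertices and of all leaves, and `w` is the weight of the leaves within one
  -- petal.
  quotientDet : Carrier → Carrier → Carrier → Carrier
  quotientDet w p q =
    (d + ⟦ + 1 ⟧) * ((d + p) * (d + ⟦ + 2 ⟧ * w - q) - (⟦ + 2 ⟧ * w - q) * (⟦ + 2 ⟧ - p)) -
    p * (d + ⟦ + 2 ⟧ * w - q + (⟦ + 2 ⟧ * w - q)) -
    q * ((⟦ + 2 ⟧ - p) + (d + p))

  columnDet-quotient : ∀ {h i j w p q} → h ≢ i →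
    columnDet (((h , zero) , ⟦ + 1 ⟧ , ⟦ + 1 ⟧) ∷ ((i , zero) , ⟦ + 1 ⟧ , p) ∷ ((i , suc j) , w , q) ∷ []) ≈
    quotientDet w p q
  columnDet-quotient {h} {i} {j} {w} {p} {q} h≢i = trans
    (determinant₃ (row c₁) (row c₂) (row c₃) c₁ c₂ c₃
      (entry-cong u₁ c₁ (δ-refl h) (δ-refl zero₀))
      (entry-cong u₁ c₂ (δ-≢ h≢i) (δ-refl zero₀))
      (entry-cong u₁ c₃ (δ-≢ h≢i) (δ-≢ 0≢))
      (entry-cong u₂ c₁ (δ-≢ (≢-sym h≢i)) (δ-refl zero₀))
      (entry-cong u₂ c₂ (δ-refl i) (δ-refl zero₀))
      (entry-cong u₂ c₃ (δ-refl i) (δ-≢ 0≢))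
      (entry-cong u₃ c₁ (δ-≢ (≢-sym h≢i)) (δ-≢ (≢-sym 0≢)))
      (entry-cong u₃ c₂ (δ-refl i) (δ-≢ (≢-sym 0≢)))
      (entry-cong u₃ c₃ (δ-refl i) (δ-refl (suc j))))
    (solve 4 (λ d w p q →
      let entry x y a π b ε = con x :* (con y :* d :+ a :* con π) :+ b :* con ε
          a₁ = entry (+ 1) (+ 1) (con (+ 1)) (+ 0) (con (+ 1)) (+ 1)
          a₂ = entry (+ 0) (+ 1) (con (+ 1)) (+ 0) p (+ 1)
          a₃ = entry (+ 0) (+ 0) w (+ 2) q -[1+ 0 ]
          b₁ = entry (+ 0) (+ 1) (con (+ 1)) (+ 0) (con (+ 1)) (+ 1)
          b₂ = entry (+ 1) (+ 1) (con (+ 1)) (+ 0) p (+ 1)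
          b₃ = entry (+ 1) (+ 0) w (+ 2) q -[1+ 0 ]
          e₁ = entry (+ 0) (+ 0) (con (+ 1)) (+ 2) (con (+ 1)) -[1+ 0 ]
          e₂ = entry (+ 1) (+ 0) (con (+ 1)) (+ 2) p -[1+ 0 ]
          e₃ = entry (+ 1) (+ 1) w (+ 2) q -[1+ 0 ]
      in a₁ :* (b₂ :* e₃ :- b₃ :* e₂) :- a₂ :* (b₁ :* e₃ :- b₃ :* e₁) :+ a₃ :* (b₁ :* e₂ :- b₂ :* e₁) :=
         (d :+ con (+ 1)) :* ((d :+ p) :* (d :+ con (+ 2) :* w :- q) :- (con (+ 2) :* w :- q) :* (con (+ 2) :- p)) :-
         p :* (d :+ con (+ 2) :* w :- q :+ (con (+ 2) :* w :- q)) :-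
         q :* ((con (+ 2) :- p) :+ (d :+ p)))
      refl d w p q)
    where
    u₁ u₂ u₃ : Label
    u₁ = h , zero
    u₂ = i , zero
    u₃ = i , suc j

    c₁ c₂ c₃ : Column
    c₁ = u₁ , ⟦ + 1 ⟧ , ⟦ + 1 ⟧
    c₂ = u₂ , ⟦ + 1 ⟧ , p
    c₃ = u₃ , w , q

    zero₀ : Fin (suc l)
    zero₀ = zero

    0≢ : zero₀ ≢ suc j
    0≢ ()

  columnDet-sunflower : ∀ {h i} is j js → Unique (h ∷ i ∷ is) →
    Distinct (((h , zero) , ⟦ + 1 ⟧ , ⟦ + 1 ⟧) ∷ concatMap (block j js) (i ∷ is)) →
    let w = add (length js) ⟦ + 1 ⟧ ⟦ + 1 ⟧ in
    columnDet (((h , zero) , ⟦ + 1 ⟧ , ⟦ + 1 ⟧) ∷ concatMap (block j js) (i ∷ is)) ≈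
    (d ^ length js) ^ suc (length is) * (blockDet zero (suc j) ⟦ + 1 ⟧ w ^ length is *
    quotientDet w (add (length is) ⟦ + 1 ⟧ ⟦ + 1 ⟧) (add (length is) w w))
  columnDet-sunflower {h} {i} is j js unique@((h≢i ∷ _) ∷ _) distinct = begin
    columnDet (hub ∷ concatMap (block j js) (i ∷ is))
      ≈⟨ proj₂ (collapse-blocks j js (hub ∷ []) (i ∷ is) distinct) ⟩
    (d ^ length js) ^ suc (length is) * columnDet (hub ∷ concatMap (collapsed j js) (i ∷ is))
      ≈⟨ *-congˡ (collapse-pairs {zero} {suc j} {⟦ + 1 ⟧} {w} {⟦ + 1 ⟧} {w} is unique) ⟩
    (d ^ length js) ^ suc (length is) * (blockDet zero (suc j) ⟦ + 1 ⟧ w ^ length is * _)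
      ≈⟨ *-congˡ (*-congˡ (columnDet-quotient {h} {i} {j} {w} h≢i)) ⟩
    _ ∎
    where
    hub = (h , zero) , ⟦ + 1 ⟧ , ⟦ + 1 ⟧
    w   = add (length js) ⟦ + 1 ⟧ ⟦ + 1 ⟧

-- Enumerations by lists, and general entries of a Seidel matrix.

tabulate-++ : ∀ {a} {A : Set a} m {n} (f : Fin (m ℕ.+ n) → A) →
  tabulate f ≡ tabulate (λ i → f (i ↑ˡ n)) ++ tabulate (λ i → f (m ↑ʳ i))
tabulate-++ zero    f = ≡.refl
tabulate-++ (suc m) f = ≡.cong (f zero ∷_) (tabulate-++ m (f ∘ suc))

tabulate-combine : ∀ {a} {A : Set a} m {n} (f : Fin (m ℕ.* n) → A) →
  tabulate f ≡ concat (tabulate λ (i : Fin m) → tabulate λ (j : Fin n) → f (combine i j))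
tabulate-combine zero        f = ≡.refl
tabulate-combine (suc m) {n} f = ≡.trans (tabulate-++ n f)
  (≡.cong (tabulate (λ j → f (j ↑ˡ m ℕ.* n)) ++_) (tabulate-combine m (λ v → f (n ↑ʳ v))))

module _ {a p} {A : Set a} {P : Pred A p} (P? : Decidable P) where

  length-filter-single : ∀ {n} (f : Fin n → A) i → P (f i) → (∀ {j} → j ≢ i → ¬ P (f j)) →
    length (filter P? (tabulate f)) ≡ 1
  length-filter-single f zero Pfi ¬P = ≡.trans (≡.cong length (filter-accept P? Pfi))
    (≡.cong (suc ∘ length) (filter-none P? (All.tabulate⁺ (λ j → ¬P {suc j} λ ()))))
  length-filter-single f (suc i) Pfi ¬P =
    ≡.trans (≡.cong length (filter-reject P? {xs = tabulate (f ∘ suc)} (¬P {zero} λ ())))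
    (length-filter-single (f ∘ suc) i Pfi (λ j≢i → ¬P (j≢i ∘ suc-injective)))

module _ {n} {x y : Fin n} {p : Subset n} where

  ⁅x⁆∪⁅y⁆⊆p⁺ : x ∈ p → y ∈ p → ⁅ x ⁆ ∪ ⁅ y ⁆ ⊆ p
  ⁅x⁆∪⁅y⁆⊆p⁺ x∈p y∈p z∈ with x∈p∪q⁻ ⁅ x ⁆ ⁅ y ⁆ z∈
  ... | inj₁ z∈x = ≡.subst (_∈ p) (≡.sym (x∈⁅y⁆⇒x≡y x z∈x)) x∈p
  ... | inj₂ z∈y = ≡.subst (_∈ p) (≡.sym (x∈⁅y⁆⇒x≡y y z∈y)) y∈p

  ⁅x⁆∪⁅y⁆⊈p : x ∉ p ⊎ y ∉ p → ¬ (⁅ x ⁆ ∪ ⁅ y ⁆ ⊆ p)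
  ⁅x⁆∪⁅y⁆⊈p (inj₁ x∉p) ⊆p = x∉p (⊆p (x∈p∪q⁺ (inj₁ (x∈⁅x⁆ x))))
  ⁅x⁆∪⁅y⁆⊈p (inj₂ y∉p) ⊆p = y∉p (⊆p (x∈p∪q⁺ {p = ⁅ x ⁆} (inj₂ (x∈⁅x⁆ y))))

seidel-diagonal : ∀ H u → seidel H u u ≡ + 0
seidel-diagonal H u with u ≟ u
... | yes _   = ≡.refl
... | no u≢u = contradiction ≡.refl u≢u

seidel-off-diagonal : ∀ H {u v} → u ≢ v →
  seidel H u v ≡ + 1 ℤ.- + 2 ℤ.* + length (filter ((⁅ u ⁆ ∪ ⁅ v ⁆) ⊆?_) (Hypergraph.edges H))
seidel-off-diagonal H {u} {v} u≢v with u ≟ v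
... | yes u≡v = contradiction u≡v u≢v
... | no _    = ≡.refl

-- Entries of the Seidel matrix of the sunflower.

module SunflowerEntries (m : ℕ) where

  open Sunflower (suc (suc m)) hiding (sunflower)

  S : Matrix ℤ _
  S = seidel (sunflower (suc (suc m)))

  v₀₀∈core : v₀₀ ∈ core
  v₀₀∈core = ∈-fromList⁺ {xs = coreVertices} (here ≡.refl)

  v∈core : ∀ i → v i zero ∈ core
  v∈core i = ∈-fromList⁺ {x = v i zero} {xs = coreVertices}
    (there (∈-map⁺ (λ i → v i first) {x = i} (∈-allFin i)))

  v∉core : ∀ i {j} → v i (suc j) ∉ core
  v∉core i {j} v∈ with ∈-fromList⁻ coreVertices v∈
  ... | there v∈′ with ∈-map⁻ (λ i → v i first) {xs = allFin (suc m)} v∈′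
  ...   | i′ , _ , eq with combine-injective i (suc j) i′ zero (suc-injective eq)
  ...     | _ , ()

  v₀₀∉petal : ∀ i → v₀₀ ∉ petal i
  v₀₀∉petal i v∈ with ∈-map⁻ (v i) (∈-fromList⁻ (petalVertices i) v∈)
  ... | _ , _ , ()

  v∈petal : ∀ i j → v i j ∈ petal i
  v∈petal i j = ∈-fromList⁺ {xs = petalVertices i} (∈-map⁺ (v i) (∈-allFin j))

  v∉petal : ∀ {i i′ j} → i′ ≢ i → v i j ∉ petal i′
  v∉petal {i} {i′} {j} i′≢i v∈ with ∈-map⁻ (v i′) (∈-fromList⁻ (petalVertices i′) v∈)
  ... | j′ , _ , eq with combine-injective i j i′ j′ (suc-injective eq)
  ...   | ≡.refl , _ = i′≢i ≡.refl

  module _ (u w : Vertex) where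

    private
      inside? = (⁅ u ⁆ ∪ ⁅ w ⁆) ⊆?_

    petals-none : (∀ i → u ∉ petal i ⊎ w ∉ petal i) →
      length (filter inside? (map petal (allFin (suc m)))) ≡ 0
    petals-none ∉petal = ≡.cong length (filter-none inside? (All.map⁺ (All.universal
      (λ i → ⁅x⁆∪⁅y⁆⊈p {p = petal i} (∉petal i)) (allFin (suc m)))))

    petals-one : ∀ i → u ∈ petal i → w ∈ petal i → (∀ {i′} → i′ ≢ i → u ∉ petal i′) →
      length (filter inside? (map petal (allFin (suc m)))) ≡ 1
    petals-one i u∈ w∈ u∉ = ≡.trans (≡.cong (length ∘ filter inside?) (map-tabulate id petal))
      (length-filter-single inside? petal i (⁅x⁆∪⁅y⁆⊆p⁺ u∈ w∈) (λ i′≢i → ⁅x⁆∪⁅y⁆⊈p (inj₁ (u∉ i′≢i))))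

    -- Distinct vertices share at most one hyperedge, so every off-diagonal entry is -1 or 1. The
    -- three lemmas treat a shared core hyperedge, a shared petal and no shared hyperedge.
    S-only-core : u ≢ w → u ∈ core → w ∈ core → (∀ i → u ∉ petal i ⊎ w ∉ petal i) → S u w ≡ -[1+ 0 ]
    S-only-core u≢w u∈ w∈ ∉petal = ≡.trans (seidel-off-diagonal (sunflower (suc (suc m))) u≢w)
      (≡.cong (λ c → + 1 ℤ.- + 2 ℤ.* + c)
        (≡.trans (≡.cong length (filter-accept inside? (⁅x⁆∪⁅y⁆⊆p⁺ u∈ w∈)))
                 (≡.cong suc (petals-none ∉petal))))

    S-only-petal : u ≢ w → u ∉ core ⊎ w ∉ core → ∀ i → u ∈ petal i → w ∈ petal i →
      (∀ {i′} → i′ ≢ i → u ∉ petal i′) → S u w ≡ -[1+ 0 ]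
    S-only-petal u≢w ∉core i u∈ w∈ u∉ = ≡.trans (seidel-off-diagonal (sunflower (suc (suc m))) u≢w)
      (≡.cong (λ c → + 1 ℤ.- + 2 ℤ.* + c)
        (≡.trans (≡.cong length (filter-reject inside? (⁅x⁆∪⁅y⁆⊈p {p = core} ∉core)))
                 (petals-one i u∈ w∈ u∉)))

    S-non-adjacent : u ≢ w → u ∉ core ⊎ w ∉ core → (∀ i → u ∉ petal i ⊎ w ∉ petal i) → S u w ≡ + 1
    S-non-adjacent u≢w ∉core ∉petal = ≡.trans (seidel-off-diagonal (sunflower (suc (suc m))) u≢w)
      (≡.cong (λ c → + 1 ℤ.- + 2 ℤ.* + c)
        (≡.trans (≡.cong length (filter-reject inside? (⁅x⁆∪⁅y⁆⊈p {p = core} ∉core)))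
                 (petals-none ∉petal)))

  v-injective : ∀ i i′ {j j′} → v i j ≡ v i′ j′ → i ≡ i′ × j ≡ j′
  v-injective i i′ {j} {j′} eq = combine-injective i j i′ j′ (suc-injective eq)

  petals-apart : ∀ {i i′} j j′ → i ≢ i′ → ∀ i″ → v i j ∉ petal i″ ⊎ v i′ j′ ∉ petal i″
  petals-apart {i} j j′ i≢i′ i″ with i″ ≟ i
  ... | yes ≡.refl = inj₂ (v∉petal i≢i′)
  ... | no  i″≢i   = inj₁ (v∉petal i″≢i)

  S-centre-core : ∀ i → S v₀₀ (v i zero) ≡ -[1+ 0 ]
  S-centre-core i = S-only-core v₀₀ (v i zero) (λ ()) v₀₀∈core (v∈core i) (inj₁ ∘ v₀₀∉petal)

  S-core-centre : ∀ i → S (v i zero) v₀₀ ≡ -[1+ 0 ]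
  S-core-centre i = S-only-core (v i zero) v₀₀ (λ ()) (v∈core i) v₀₀∈core (inj₂ ∘ v₀₀∉petal)

  S-centre-leaf : ∀ i j → S v₀₀ (v i (suc j)) ≡ + 1
  S-centre-leaf i j = S-non-adjacent v₀₀ (v i (suc j)) (λ ()) (inj₂ (v∉core i)) (inj₁ ∘ v₀₀∉petal)

  S-leaf-centre : ∀ i j → S (v i (suc j)) v₀₀ ≡ + 1
  S-leaf-centre i j = S-non-adjacent (v i (suc j)) v₀₀ (λ ()) (inj₁ (v∉core i)) (inj₂ ∘ v₀₀∉petal)

  S-same-petal : ∀ i {j j′} → j ≢ j′ → S (v i j) (v i j′) ≡ -[1+ 0 ]
  S-same-petal i {j} {j′} j≢j′ = S-only-petal (v i j) (v i j′) (j≢j′ ∘ proj₂ ∘ v-injective i i)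
    (not-both j j′ j≢j′) i (v∈petal i j) (v∈petal i j′) v∉petal
    where
    -- A petal meets the core hyperedge in position zero alone, so the pair is not counted a second
    -- time there.
    not-both : ∀ j j′ → j ≢ j′ → v i j ∉ core ⊎ v i j′ ∉ core
    not-both zero    zero    0≢0 = contradiction ≡.refl 0≢0
    not-both zero    (suc _) _   = inj₂ (v∉core i)
    not-both (suc _) _       _   = inj₁ (v∉core i)

  S-core-core : ∀ {i i′} → i ≢ i′ → S (v i zero) (v i′ zero) ≡ -[1+ 0 ]
  S-core-core {i} {i′} i≢i′ = S-only-core (v i zero) (v i′ zero) (i≢i′ ∘ proj₁ ∘ v-injective i i′)
    (v∈core i) (v∈core i′) (petals-apart zero zero i≢i′)

  S-leaf-far : ∀ {i i′} j j′ → i ≢ i′ → S (v i (suc j)) (v i′ j′) ≡ + 1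
  S-leaf-far {i} {i′} j j′ i≢i′ = S-non-adjacent (v i (suc j)) (v i′ j′) (i≢i′ ∘ proj₁ ∘ v-injective i i′)
    (inj₁ (v∉core i)) (petals-apart (suc j) j′ i≢i′)

  S-far-leaf : ∀ {i i′} j j′ → i ≢ i′ → S (v i j) (v i′ (suc j′)) ≡ + 1
  S-far-leaf {i} {i′} j j′ i≢i′ = S-non-adjacent (v i j) (v i′ (suc j′)) (i≢i′ ∘ proj₁ ∘ v-injective i i′)
    (inj₂ (v∉core i′)) (petals-apart j (suc j′) i≢i′)

-- Agreement with the Laplace expansion along the first row.

module LaplaceExpansion {c ℓ₁ ℓ₂ i} (K : HeytingField c ℓ₁ ℓ₂) (I : Set i) where

  open Spectra K using (ring; det)
  open CommutativeRing ring hiding (zero; ring)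
  open Determinants ring I
  open IntegerCoefficients ring
  open import Algebra.Properties.Ring (CommutativeRing.ring ring) using (-0#≈0#; -1*x≈-x; -‿distribˡ-*)
  open import Algebra.Properties.Monoid.Sum +-monoid using (sum; sum-cong-≋)
  open import Algebra.Properties.Semiring.Exp semiring using (_^_)
  open import Relation.Binary.Reasoning.Setoid setoid

  sum-neg : ∀ {n} (t : Vector Carrier n) → - sum t ≈ sum (λ j → - t j)
  sum-neg {zero}  t = -0#≈0#
  sum-neg {suc n} t = trans (solve 2 (λ x y → :- (x :+ y) := :- x :+ :- y) refl (t zero) (sum (t ∘ suc)))
                            (+-congˡ (sum-neg (t ∘ suc)))

  -- The nested subtractions of `_⌟_` unfold to an alternating sum: each outer minus sign raises the
  -- exponents of all later terms by one.
  ⌟-tabulate : ∀ {n} r f (γ : Fin (suc n) → I) →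
    (r ⌟ f) (tabulate γ) ≈ sum λ j → (- 1#) ^ toℕ j * r (γ j) * f (tabulate (removeAt γ j))
  ⌟-tabulate {zero}  r f γ = +-cong (*-congʳ (sym (*-identityˡ _))) -0#≈0#
  ⌟-tabulate {suc n} r f γ = +-cong (*-congʳ (sym (*-identityˡ _))) (begin
    - (r ⌟ (λ cs → f (γ zero ∷ cs))) (tabulate (γ ∘ suc))
      ≈⟨ -‿cong (⌟-tabulate r (λ cs → f (γ zero ∷ cs)) (γ ∘ suc)) ⟩
    - sum t
      ≈⟨ sum-neg t ⟩
    sum (λ j → - t j)
      ≈⟨ sum-cong-≋ negate ⟩
    sum (t⁺ ∘ suc) ∎)
    where
    t : Vector Carrier (suc n)
    t j = (- 1#) ^ toℕ j * r (γ (suc j)) * f (γ zero ∷ tabulate (removeAt (γ ∘ suc) j))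

    t⁺ : Vector Carrier (suc (suc n))
    t⁺ j = (- 1#) ^ toℕ j * r (γ j) * f (tabulate (removeAt γ j))

    negate : ∀ j → - t j ≈ t⁺ (suc j)
    negate j = trans (-‿distribˡ-* _ _) (*-congʳ (trans (-‿distribˡ-* _ _) (*-congʳ (sym (-1*x≈-x _)))))

  det≈determinant : ∀ {n} (M : Matrix Carrier n) (ρ : Fin n → Row) (γ : Fin n → I) →
    (∀ i j → M i j ≈ ρ i (γ j)) → det M ≈ determinant (tabulate ρ) (tabulate γ)
  det≈determinant {zero}  M ρ γ M≈ = refl
  det≈determinant {suc n} M ρ γ M≈ = sym (begin
    determinant (tabulate ρ) (tabulate γ)
      ≈⟨ ⌟-tabulate (ρ zero) (determinant (tabulate (ρ ∘ suc))) γ ⟩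
    sum (λ j → (- 1#) ^ toℕ j * ρ zero (γ j) * determinant (tabulate (ρ ∘ suc)) (tabulate (removeAt γ j)))
      ≈⟨ sum-cong-≋ minor ⟩
    det M ∎)
    where
    minor : ∀ j → (- 1#) ^ toℕ j * ρ zero (γ j) * determinant (tabulate (ρ ∘ suc)) (tabulate (removeAt γ j)) ≈
                  (- 1#) ^ toℕ j * M zero j * det (λ i → removeAt (M (suc i)) j)
    minor j = *-cong (*-congˡ (sym (M≈ zero j)))
      (sym (det≈determinant (λ i → removeAt (M (suc i)) j) (ρ ∘ suc) (removeAt γ j)
        (λ i j′ → M≈ (suc i) (punchIn j j′))))

-- Integer polynomials in `k` as ring elements.

module IntegerImages {c ℓ₁ ℓ₂} (K : HeytingField c ℓ₁ ℓ₂) (m : ℕ) where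

  open Spectra K using (ring; ι)
  open CommutativeRing ring hiding (zero; ring)
  open IntegerCoefficients ring
  open import Algebra.Properties.Semiring.Exp semiring using (_^_)

  μ : Carrier
  μ = ⟦ + m ⟧

  k : ℤ
  k = + suc (suc m)

  -- Derivations follow the shape of an integer expression and carry it into the ring. It is a
  -- record because `⟦_⟧` computes, so the integer could not be inferred from the bare equation.
  record _↦_ (i : ℤ) (a : Carrier) : Set ℓ₁ where
    constructor ⟨_⟩
    field
      image : ⟦ i ⟧ ≈ a

  open _↦_

  infix  4 _↦_
  infixl 6 _⊕_ _⊖_
  infixl 7 _⊗_

  _⊕_ : ∀ {i j a b} → i ↦ a → j ↦ b → i ℤ.+ j ↦ a + b
  _⊕_ {i} {j} p q = ⟨ trans (⟦⟧-+ i j) (+-cong (image p) (image q)) ⟩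

  _⊖_ : ∀ {i j a b} → i ↦ a → j ↦ b → i ℤ.- j ↦ a - b
  _⊖_ {i} {j} p q = ⟨ trans (⟦⟧-+ i (ℤ.- j)) (+-cong (image p) (trans (⟦⟧-neg j) (-‿cong (image q)))) ⟩

  _⊗_ : ∀ {i j a b} → i ↦ a → j ↦ b → i ℤ.* j ↦ a * b
  _⊗_ {i} {j} p q = ⟨ trans (⟦⟧-* i j) (*-cong (image p) (image q)) ⟩

  power : ∀ {i a} n → i ↦ a → i ℤ.^ n ↦ a ^ n
  power zero    p = ⟨ +-identityʳ 1# ⟩
  power (suc n) p = p ⊗ power n p

  constant : ∀ i → i ↦ ⟦ i ⟧
  constant i = ⟨ refl ⟩

  κ : k ↦ ⟦ + 2 ⟧ + μ
  κ = ⟨ ⟦⟧-+ (+ 2) (+ m) ⟩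

  -- Separately defined functions with equal clauses agree by computation only once the integer
  -- shows its constructor.
  ι≈ : ∀ {i a} → i ↦ a → ι i ≈ a
  ι≈ {+ n}      p = image p
  ι≈ { -[1+ n ]} p = image p

-- The characteristic polynomial of the sunflower.

module SunflowerDeterminant {c ℓ₁ ℓ₂} (K : HeytingField c ℓ₁ ℓ₂) (m : ℕ) (x : HeytingField.Carrier K) where

  open Spectra K using (ring; ι; charPoly; sunflowerCubic)
  open CommutativeRing ring hiding (zero; ring)
  open IntegerCoefficients ring
  open import Relation.Binary.Reasoning.Setoid setoid
  open import Algebra.Properties.Semiring.Exp semiring using (_^_)
  open Sunflower (suc (suc m)) hiding (sunflower)
  open SunflowerEntries m
  open WeightedSeidel ring (suc (suc m)) (suc m) (x - ⟦ + 1 ⟧)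
  open Determinants ring Column
  open LaplaceExpansion K Column
  open IntegerImages K m

  -- Petal `i` becomes block `suc i`, with block zero reserved for the centre. The centre takes
  -- position zero because it meets every petal exactly as a core vertex of another petal does.
  label : Vertex → Label
  label zero    = zero , zero
  label (suc u) = suc (proj₁ (remQuot (suc (suc m)) u)) , proj₂ (remQuot {suc m} (suc (suc m)) u)

  label-v : ∀ i j → label (v i j) ≡ (suc i , j)
  label-v i j = ≡.cong (λ (i , j) → suc i , j) (remQuot-combine i j)

  column : Label → Column
  column u = u , ⟦ + 1 ⟧ , ⟦ + 1 ⟧

  -- `remQuot` does not reduce on `combine`, so vertices are analysed through this view and their
  -- labels are rewritten by `label-v`.
  data View : Vertex → Set where
    centre : View v₀₀
    at     : ∀ i j → View (v i j)

  view : ∀ u → View u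
  view zero    = centre
  view (suc u) = ≡.subst (View ∘ suc) (combine-remQuot {suc m} (suc (suc m)) u)
    (at (proj₁ (remQuot (suc (suc m)) u)) (proj₂ (remQuot {suc m} (suc (suc m)) u)))

  label-injective : ∀ {u w} → label u ≡ label w → u ≡ w
  label-injective {u} {w} eq with view u | view w
  ... | centre | centre = ≡.refl
  ... | centre | at i j with () ← ≡.trans eq (label-v i j)
  ... | at i j | centre with () ← ≡.trans (≡.sym eq) (label-v i j)
  ... | at i j | at i′ j′ with ≡.refl ← ≡.trans (≡.sym (label-v i j)) (≡.trans eq (label-v i′ j′)) = ≡.refl

  characteristic : Matrix Carrier _
  characteristic u w = x * ι (identity _ u w) - ι (S u w)

  diagonal : ∀ u → characteristic u u ≈ x
  diagonal u = begin
    x * ι (identity _ u u) - ι (S u u)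
      ≡⟨ ≡.cong₂ (λ a b → x * ι a - ι b) (identity-refl u) (seidel-diagonal (sunflower (suc (suc m))) u) ⟩
    x * ⟦ + 1 ⟧ - ⟦ + 0 ⟧
      ≈⟨ solve 1 (λ x → x :* con (+ 1) :- con (+ 0) := x) refl x ⟩
    x ∎

  off-diagonal : ∀ {u w z} → u ≢ w → S u w ≡ z → characteristic u w ≈ - ι z
  off-diagonal {u} {w} {z} u≢w S≡z = begin
    x * ι (identity _ u w) - ι (S u w)
      ≡⟨ ≡.cong₂ (λ a b → x * ι a - ι b) (identity-≢ u≢w) S≡z ⟩
    x * 0# - ι z
      ≈⟨ +-congʳ (zeroʳ x) ⟩
    0# - ι z
      ≈⟨ +-identityˡ _ ⟩
    - ι z ∎

  entry-diagonal : ∀ u → entry u (column u) ≈ x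
  entry-diagonal u@(i , j) = trans (entry-cong u (column u) (δ-refl i) (δ-refl j)) (π+ε j)
    where
    π+ε : ∀ j → ⟦ + 1 ⟧ * (⟦ + 1 ⟧ * (x - ⟦ + 1 ⟧) + ⟦ + 1 ⟧ * π j j) + ⟦ + 1 ⟧ * ε j j ≈ x
    π+ε zero = solve 1 (λ x → con (+ 1) :* (con (+ 1) :* (x :- con (+ 1)) :+ con (+ 1) :* con (+ 0)) :+
      con (+ 1) :* con (+ 1) := x) refl x
    π+ε (suc _) = solve 1 (λ x → con (+ 1) :* (con (+ 1) :* (x :- con (+ 1)) :+ con (+ 1) :* con (+ 2)) :+
      con (+ 1) :* con -[1+ 0 ] := x) refl x

  entry-same-petal : ∀ i {j j′} → j ≢ j′ → entry (i , j) (column (i , j′)) ≈ - ⟦ -[1+ 0 ] ⟧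
  entry-same-petal i {j} {j′} j≢j′ =
    trans (entry-cong (i , j) (column (i , j′)) (δ-refl i) (δ-≢ j≢j′)) (π+ε j j′ j≢j′)
    where
    one : ⟦ + 1 ⟧ * (⟦ + 0 ⟧ * (x - ⟦ + 1 ⟧) + ⟦ + 1 ⟧ * ⟦ + 2 ⟧) + ⟦ + 1 ⟧ * ⟦ -[1+ 0 ] ⟧ ≈ - ⟦ -[1+ 0 ] ⟧
    one = solve 1 (λ x → con (+ 1) :* (con (+ 0) :* (x :- con (+ 1)) :+ con (+ 1) :* con (+ 2)) :+
      con (+ 1) :* con -[1+ 0 ] := :- con -[1+ 0 ]) refl x

    π+ε : ∀ j j′ → j ≢ j′ →
      ⟦ + 1 ⟧ * (⟦ + 0 ⟧ * (x - ⟦ + 1 ⟧) + ⟦ + 1 ⟧ * π j j′) + ⟦ + 1 ⟧ * ε j j′ ≈ - ⟦ -[1+ 0 ] ⟧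
    π+ε zero    zero    0≢0 = contradiction ≡.refl 0≢0
    π+ε zero    (suc _) _   = one
    π+ε (suc _) _       _   = one

  entry-far : ∀ u w z → proj₁ u ≢ proj₁ w → - ι z ≈ ε (proj₂ u) (proj₂ w) → entry u (column w) ≈ - ι z
  entry-far u w z i≢i′ z≈ = begin
    entry u (column w)
      ≈⟨ entry-cong u (column w) (δ-≢ i≢i′) refl ⟩
    ⟦ + 0 ⟧ * (δ (proj₂ u) (proj₂ w) * (x - ⟦ + 1 ⟧) + ⟦ + 1 ⟧ * π (proj₂ u) (proj₂ w)) +
      ⟦ + 1 ⟧ * ε (proj₂ u) (proj₂ w)
      ≈⟨ solve 2 (λ y e → con (+ 0) :* y :+ con (+ 1) :* e := e) refl _ _ ⟩
    ε (proj₂ u) (proj₂ w)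
      ≈⟨ z≈ ⟨
    - ι z ∎

  characteristic-far : ∀ a b u w z → a ≢ b → S a b ≡ z →
    proj₁ u ≢ proj₁ w → - ι z ≈ ε (proj₂ u) (proj₂ w) →
    characteristic a b ≈ entry u (column w)
  characteristic-far a b u w z a≢b S≡z i≢i′ z≈ = trans (off-diagonal a≢b S≡z) (sym (entry-far u w z i≢i′ z≈))

  minus-minus : - ⟦ -[1+ 0 ] ⟧ ≈ ⟦ + 1 ⟧
  minus-minus = solve 0 (:- con -[1+ 0 ] := con (+ 1)) refl

  characteristic-petals : ∀ i j i′ j′ → characteristic (v i j) (v i′ j′) ≈ entry (suc i , j) (column (suc i′ , j′))
  characteristic-petals i j i′ j′ = cases (i ≟ i′) (j ≟ j′)
    where
    module _ (i≢i′ : i ≢ i′) where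

      apart : ∀ {j j′} → v i j ≢ v i′ j′
      apart = i≢i′ ∘ proj₁ ∘ v-injective i i′

      far : ∀ j j′ → characteristic (v i j) (v i′ j′) ≈ entry (suc i , j) (column (suc i′ , j′))
      far zero    zero     = characteristic-far (v i zero) (v i′ zero) (suc i , zero) (suc i′ , zero) -[1+ 0 ]
        apart (S-core-core i≢i′) (i≢i′ ∘ suc-injective) minus-minus
      far zero    (suc j′) = characteristic-far (v i zero) (v i′ (suc j′)) (suc i , zero) (suc i′ , suc j′) (+ 1)
        apart (S-far-leaf zero j′ i≢i′) (i≢i′ ∘ suc-injective) refl
      far (suc j) j′       = characteristic-far (v i (suc j)) (v i′ j′) (suc i , suc j) (suc i′ , j′) (+ 1)
        apart (S-leaf-far j j′ i≢i′) (i≢i′ ∘ suc-injective) refl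

    cases : Dec (i ≡ i′) → Dec (j ≡ j′) → characteristic (v i j) (v i′ j′) ≈ entry (suc i , j) (column (suc i′ , j′))
    cases (yes ≡.refl) (yes ≡.refl) = trans (diagonal (v i j)) (sym (entry-diagonal (suc i , j)))
    cases (yes ≡.refl) (no j≢j′)    = trans (off-diagonal (j≢j′ ∘ proj₂ ∘ v-injective i i) (S-same-petal i j≢j′))
                                            (sym (entry-same-petal (suc i) j≢j′))
    cases (no i≢i′)    _            = far i≢i′ j j′

  relabel : ∀ a b {u w} → label a ≡ u → label b ≡ w →
    characteristic a b ≈ entry u (column w) → characteristic a b ≈ entry (label a) (column (label b))
  relabel a b ≡.refl ≡.refl eq = eq

  characteristic-entry : ∀ a b → characteristic a b ≈ entry (label a) (column (label b))
  characteristic-entry a b with view a | view b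
  ... | centre       | centre       = trans (diagonal v₀₀) (sym (entry-diagonal (zero , zero)))
  ... | centre       | at i zero    = relabel v₀₀ (v i zero) ≡.refl (label-v i zero)
    (characteristic-far v₀₀ (v i zero) (zero , zero) (suc i , zero) -[1+ 0 ] (λ ()) (S-centre-core i) (λ ()) minus-minus)
  ... | centre       | at i (suc j) = relabel v₀₀ (v i (suc j)) ≡.refl (label-v i (suc j))
    (characteristic-far v₀₀ (v i (suc j)) (zero , zero) (suc i , suc j) (+ 1) (λ ()) (S-centre-leaf i j) (λ ()) refl)
  ... | at i zero    | centre       = relabel (v i zero) v₀₀ (label-v i zero) ≡.refl
    (characteristic-far (v i zero) v₀₀ (suc i , zero) (zero , zero) -[1+ 0 ] (λ ()) (S-core-centre i) (λ ()) minus-minus)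
  ... | at i (suc j) | centre       = relabel (v i (suc j)) v₀₀ (label-v i (suc j)) ≡.refl
    (characteristic-far (v i (suc j)) v₀₀ (suc i , suc j) (zero , zero) (+ 1) (λ ()) (S-leaf-centre i j) (λ ()) refl)
  ... | at i j       | at i′ j′     = relabel (v i j) (v i′ j′) (label-v i j) (label-v i′ j′)
    (characteristic-petals i j i′ j′)

  -- Of the `k - 1` leaves in a petal, and of the `k - 1` petals, one survives; the lists hold the
  -- `m = k - 2` that are absorbed.
  leaves : List (Fin (suc m))
  leaves = tabulate (λ (j : Fin m) → suc j)

  otherPetals : List (Fin (suc (suc m)))
  otherPetals = tabulate (λ (i : Fin m) → suc (suc i))

  columns-blocks : tabulate (column ∘ label) ≡
    column (zero , zero) ∷ concatMap (block zero leaves) (suc zero ∷ otherPetals)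
  columns-blocks = ≡.cong (column (zero , zero) ∷_) 
    (≡.trans (tabulate-combine (suc m) (column ∘ label ∘ suc))
    (≡.trans (≡.cong concat (tabulate-cong petal-columns))
             (≡.cong concat (≡.sym (map-tabulate suc (block zero leaves))))))
    where
    petal-columns : ∀ i → (tabulate λ j → column (label (v i j))) ≡ block zero leaves (suc i)
    petal-columns i = ≡.trans (tabulate-cong (λ j → ≡.cong column (label-v i j)))
      (≡.cong (λ cs → column (suc i , zero) ∷ leaf (suc i) zero ∷ cs) (≡.sym (map-tabulate suc (leaf (suc i)))))

  columns-distinct : Distinct (tabulate (column ∘ label))
  columns-distinct = AllPairs.tabulate⁺ {f = column ∘ label} (λ a≢b eq → a≢b (label-injective eq))

  w : Carrier
  w = add m ⟦ + 1 ⟧ ⟦ + 1 ⟧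

  charPoly-sunflower : charPoly S x ≈
    ((x - ⟦ + 1 ⟧) ^ m) ^ suc m *
    (blockDet zero (suc zero) ⟦ + 1 ⟧ w ^ m * quotientDet w (add m ⟦ + 1 ⟧ ⟦ + 1 ⟧) (add m w w))
  charPoly-sunflower = begin
    charPoly S x
      ≈⟨ det≈determinant _ (row ∘ column ∘ label) (column ∘ label) characteristic-entry ⟩
    determinant (tabulate (row ∘ column ∘ label)) (tabulate (column ∘ label))
      ≡⟨ ≡.cong (λ rs → determinant rs (tabulate (column ∘ label))) (map-tabulate (column ∘ label) row) ⟨
    columnDet (tabulate (column ∘ label))
      ≡⟨ ≡.cong columnDet columns-blocks ⟩
    columnDet (column (zero , zero) ∷ concatMap (block zero leaves) (suc zero ∷ otherPetals))
      -- The block of the centre, the first petal and `otherPetals` together are `allFin` by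
      -- computation.
      ≈⟨ columnDet-sunflower otherPetals zero leaves (Unique.allFin⁺ (suc (suc m)))
           (≡.subst Distinct columns-blocks columns-distinct) ⟩
    factors (length leaves) (length otherPetals)
      ≡⟨ ≡.cong₂ factors (length-tabulate (λ (i : Fin m) → Fin.suc i))
                           (length-tabulate (λ (i : Fin m) → Fin.suc (Fin.suc i))) ⟩
    factors m m ∎
    where
    factors : ℕ → ℕ → Carrier
    factors p q = let w = add p ⟦ + 1 ⟧ ⟦ + 1 ⟧ in
      ((x - ⟦ + 1 ⟧) ^ p) ^ suc q *
      (blockDet zero (suc zero) ⟦ + 1 ⟧ w ^ q * quotientDet w (add q ⟦ + 1 ⟧ ⟦ + 1 ⟧) (add q w w))

  add≈ : ∀ n a b → add n a b ≈ b + ⟦ + n ⟧ * a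
  add≈ zero    a b = solve 2 (λ a b → b := b :+ con (+ 0) :* a) refl a b
  add≈ (suc n) a b = begin
    add n a (b + a)               ≈⟨ add≈ n a (b + a) ⟩
    b + a + ⟦ + n ⟧ * a           ≈⟨ solve 3 (λ a b n → b :+ a :+ n :* a := b :+ (con (+ 1) :+ n) :* a) refl a b ⟦ + n ⟧ ⟩
    b + (⟦ + 1 ⟧ + ⟦ + n ⟧) * a   ≈⟨ +-congˡ (*-congʳ (⟦⟧-+ (+ 1) (+ n))) ⟨
    b + ⟦ + suc n ⟧ * a           ∎

  w≈ : w ≈ ⟦ + 1 ⟧ + μ
  w≈ = trans (add≈ m _ _) (solve 1 (λ μ → con (+ 1) :+ μ :* con (+ 1) := con (+ 1) :+ μ) refl μ)

  add-w≈ : add m w w ≈ (⟦ + 1 ⟧ + μ) * (⟦ + 1 ⟧ + μ)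
  add-w≈ = trans (add≈ m w w) (trans (solve 2 (λ w μ → w :+ μ :* w := (con (+ 1) :+ μ) :* w) refl w μ) (*-congˡ w≈))

  -- The underlying matrix has rows `(d, 2 * w)` and `(2, d + 2 * w)` with `d = x - 1` and
  -- `w = k - 1`.
  blockDet≈ : blockDet zero (suc zero) ⟦ + 1 ⟧ w ≈
    (x - ⟦ + 1 ⟧) * (x - ⟦ + 1 ⟧ + ⟦ + 2 ⟧ * (⟦ + 1 ⟧ + μ)) - ⟦ + 4 ⟧ * (⟦ + 1 ⟧ + μ)
  blockDet≈ = trans
    (solve 2 (λ x w →
      (con (+ 1) :* (x :- con (+ 1)) :+ con (+ 1) :* con (+ 0)) :* (con (+ 1) :* (x :- con (+ 1)) :+ w :* con (+ 2)) :-
      (con (+ 0) :* (x :- con (+ 1)) :+ w :* con (+ 2)) :* (con (+ 0) :* (x :- con (+ 1)) :+ con (+ 1) :* con (+ 2)) :=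
      (x :- con (+ 1)) :* (x :- con (+ 1) :+ con (+ 2) :* w) :- con (+ 4) :* w) refl x w)
    (+-cong (*-congˡ (+-congˡ (*-congˡ w≈))) (-‿cong (*-congˡ w≈)))

  quotientDet-cong : ∀ {w w′ p p′ q q′} → w ≈ w′ → p ≈ p′ → q ≈ q′ → quotientDet w p q ≈ quotientDet w′ p′ q′
  quotientDet-cong {w} {w′} {p} {p′} {q} {q′} w≈ p≈ q≈ = +-cong (+-cong
    (*-congˡ (+-cong (*-cong (+-congˡ p≈) outer) (-‿cong (*-cong inner 2-p))))
    (-‿cong (*-cong p≈ (+-cong outer inner))))
    (-‿cong (*-cong q≈ (+-cong 2-p (+-congˡ p≈))))
    where
    inner : ⟦ + 2 ⟧ * w - q ≈ ⟦ + 2 ⟧ * w′ - q′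
    inner = +-cong (*-congˡ w≈) (-‿cong q≈)

    outer : x - ⟦ + 1 ⟧ + ⟦ + 2 ⟧ * w - q ≈ x - ⟦ + 1 ⟧ + ⟦ + 2 ⟧ * w′ - q′
    outer = +-cong (+-congˡ (*-congˡ w≈)) (-‿cong q≈)

    2-p : ⟦ + 2 ⟧ - p ≈ ⟦ + 2 ⟧ - p′
    2-p = +-congˡ (-‿cong p≈)

  quotientDet≈cubic : quotientDet w (add m ⟦ + 1 ⟧ ⟦ + 1 ⟧) (add m w w) ≈ sunflowerCubic k x
  quotientDet≈cubic = begin
    -- There are as many petals as leaves in a petal, namely `k - 1`, so `w` is also the total
    -- weight of the core vertices.
    quotientDet w w (add m w w)
      ≈⟨ quotientDet-cong w≈ w≈ add-w≈ ⟩
    quotientDet (⟦ + 1 ⟧ + μ) (⟦ + 1 ⟧ + μ) ((⟦ + 1 ⟧ + μ) * (⟦ + 1 ⟧ + μ))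
      ≈⟨ solve 2 (λ x μ →
        let d = x :- con (+ 1); w = con (+ 1) :+ μ; p = w; q = w :* w; k = con (+ 2) :+ μ in
        (d :+ con (+ 1)) :* ((d :+ p) :* (d :+ con (+ 2) :* w :- q) :- (con (+ 2) :* w :- q) :* (con (+ 2) :- p)) :-
        p :* (d :+ con (+ 2) :* w :- q :+ (con (+ 2) :* w :- q)) :-
        q :* ((con (+ 2) :- p) :+ (d :+ p)) :=
        x :^ 3 :-
        (con (+ 6) :- con (+ 5) :* k :+ k :^ 2) :* x :^ 2 :-
        (con (ℤ.- + 17) :+ con (+ 26) :* k :- con (+ 12) :* k :^ 2 :+ con (+ 2) :* k :^ 3) :* x :+
        (con (ℤ.- + 8) :+ con (+ 17) :* k :- con (+ 11) :* k :^ 2 :+ con (+ 2) :* k :^ 3))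
        refl x μ ⟩
    _ ≈⟨ +-cong (+-cong (+-congˡ (-‿cong (*-congʳ (ι≈ c₂)))) (-‿cong (*-congʳ (ι≈ c₁)))) (ι≈ c₀) ⟨
    sunflowerCubic k x ∎
    where
    c₂ = constant (+ 6) ⊖ constant (+ 5) ⊗ κ ⊕ power 2 κ
    c₁ = constant (ℤ.- + 17) ⊕ constant (+ 26) ⊗ κ ⊖ constant (+ 12) ⊗ power 2 κ ⊕ constant (+ 2) ⊗ power 3 κ
    c₀ = constant (ℤ.- + 8) ⊕ constant (+ 17) ⊗ κ ⊖ constant (+ 11) ⊗ power 2 κ ⊕ constant (+ 2) ⊗ power 3 κ

-- The spectrum.

theorem6p3 : ∀ {c ℓ₁ ℓ₂} (K : HeytingField c ℓ₁ ℓ₂) →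
    let open Spectra K in
    CharacteristicZero →
    (k : ℕ) .{{_ : NonTrivial k}} →
    (s r₁ r₂ r₃ : Carrier) →
    s * s ≈ ι ((+ k ℤ.+ + 3) ℤ.* (+ k ℤ.- + 1)) →
    RootsWithMultiplicity (sunflowerCubic (+ k)) (r₁ ∷ r₂ ∷ r₃ ∷ []) →
    HasSpectrum (seidel (sunflower k))
    ( (1# , (k ∸ 1) ℕ.* (k ∸ 2))
    ∷ (ι (+ 2 ℤ.- + k) + s , k ∸ 2)
    ∷ (ι (+ 2 ℤ.- + k) - s , k ∸ 2)
    ∷ (r₁ , 1)
    ∷ (r₂ , 1)
    ∷ (r₃ , 1)
    ∷ [])
theorem6p3 K _ zero {{nt}} _ _ _ _ _ _ _ = contradiction (ℕ.nonTrivial⇒n>1 0 {{nt}}) λ ()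
theorem6p3 K _ (suc zero) {{nt}} _ _ _ _ _ _ _ = contradiction (ℕ.nonTrivial⇒n>1 1 {{nt}}) λ { (ℕ.s≤s ()) }
theorem6p3 K _ (suc (suc m)) s r₁ r₂ r₃ s² roots x = begin
  charPoly S x
    ≈⟨ charPoly-sunflower ⟩
  ((x - ⟦ + 1 ⟧) ^ m) ^ suc m *
  (blockDet zero (suc zero) ⟦ + 1 ⟧ w ^ m * quotientDet w (add m ⟦ + 1 ⟧ ⟦ + 1 ⟧) (add m w w))
    ≈⟨ *-cong ones (*-cong pairs (trans quotientDet≈cubic (roots x))) ⟩
  (x - 1#) ^ (suc m ℕ.* m) * ((x - p) ^ m * (x - q) ^ m * product rs)
    ≈⟨ *-congˡ (*-assoc _ _ _) ⟩
  (x - 1#) ^ (suc m ℕ.* m) * ((x - p) ^ m * ((x - q) ^ m * product rs))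
    ≈⟨ *-congˡ (*-congˡ (product-replicate m q rs)) ⟨
  (x - 1#) ^ (suc m ℕ.* m) * ((x - p) ^ m * product (replicate m q ++ rs))
    ≈⟨ *-congˡ (product-replicate m _ _) ⟨
  (x - 1#) ^ (suc m ℕ.* m) * product (replicate m p ++ replicate m q ++ rs)
    ≈⟨ product-replicate (suc m ℕ.* m) 1# _ ⟨
  product (replicate (suc m ℕ.* m) 1# ++ replicate m p ++ replicate m q ++ rs) ∎
  where
  open Spectra K using (ring; ι; charPoly; sunflowerCubic)
  open CommutativeRing ring hiding (zero; ring)
  open IntegerCoefficients ring
  open import Algebra.Properties.CommutativeSemiring.Exp commutativeSemiring
    using (_^_; ^-congˡ; ^-assocʳ; ^-distrib-*)
  open import Relation.Binary.Reasoning.Setoid setoid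
  open SunflowerEntries m using (S)
  open WeightedSeidel ring (suc (suc m)) (suc m) (x - ⟦ + 1 ⟧) using (blockDet; quotientDet; add)
  open SunflowerDeterminant K m x
  open IntegerImages K m

  p q : Carrier
  p = ι (+ 2 ℤ.- k) + s
  q = ι (+ 2 ℤ.- k) - s

  rs : List Carrier
  rs = r₁ ∷ r₂ ∷ r₃ ∷ []

  product : List Carrier → Carrier
  product ys = foldr _*_ 1# (map (λ r → x - r) ys)

  product-replicate : ∀ n r rs → product (replicate n r ++ rs) ≈ (x - r) ^ n * product rs
  product-replicate zero    r rs = sym (*-identityˡ _)
  product-replicate (suc n) r rs = trans (*-congˡ (product-replicate n r rs)) (sym (*-assoc _ _ _))

  ones : ((x - ⟦ + 1 ⟧) ^ m) ^ suc m ≈ (x - 1#) ^ (suc m ℕ.* m)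
  ones = begin
    ((x - ⟦ + 1 ⟧) ^ m) ^ suc m      ≈⟨ ^-assocʳ (x - ⟦ + 1 ⟧) m (suc m) ⟩
    (x - ⟦ + 1 ⟧) ^ (m ℕ.* suc m)    ≡⟨ ≡.cong ((x - ⟦ + 1 ⟧) ^_) (ℕ.*-comm m (suc m)) ⟩
    (x - ⟦ + 1 ⟧) ^ (suc m ℕ.* m)    ≈⟨ ^-congˡ (suc m ℕ.* m) (+-congˡ (-‿cong (+-identityʳ 1#))) ⟩
    (x - 1#) ^ (suc m ℕ.* m)         ∎

  pair : blockDet zero (suc zero) ⟦ + 1 ⟧ w ≈ (x - p) * (x - q)
  pair = begin
    blockDet zero (suc zero) ⟦ + 1 ⟧ w
      ≈⟨ blockDet≈ ⟩
    (x - ⟦ + 1 ⟧) * (x - ⟦ + 1 ⟧ + ⟦ + 2 ⟧ * (⟦ + 1 ⟧ + μ)) - ⟦ + 4 ⟧ * (⟦ + 1 ⟧ + μ)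
      -- Completing the square in `x - 1` produces the constant `(k - 1)² + 4 (k - 1)`, which is
      -- `(k + 3) (k - 1)`.
      ≈⟨ solve 2 (λ x μ →
        let k = con (+ 2) :+ μ; c = con (+ 2) :- k in
        (x :- con (+ 1)) :* (x :- con (+ 1) :+ con (+ 2) :* (con (+ 1) :+ μ)) :- con (+ 4) :* (con (+ 1) :+ μ) :=
        (x :- c) :* (x :- c) :- (k :+ con (+ 3)) :* (k :- con (+ 1))) refl x μ ⟩
    (x - (⟦ + 2 ⟧ - (⟦ + 2 ⟧ + μ))) * (x - (⟦ + 2 ⟧ - (⟦ + 2 ⟧ + μ))) -
    (⟦ + 2 ⟧ + μ + ⟦ + 3 ⟧) * (⟦ + 2 ⟧ + μ - ⟦ + 1 ⟧)
      ≈⟨ +-cong (*-cong shift shift) (-‿cong (trans s² (ι≈ ((κ ⊕ constant (+ 3)) ⊗ (κ ⊖ constant (+ 1)))))) ⟨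
    (x - ι (+ 2 ℤ.- k)) * (x - ι (+ 2 ℤ.- k)) - s * s
      ≈⟨ solve 3 (λ x c s → (x :- c) :* (x :- c) :- s :* s := (x :- (c :+ s)) :* (x :- (c :- s)))
        refl x (ι (+ 2 ℤ.- k)) s ⟩
    (x - p) * (x - q) ∎
    where
    shift : x - ι (+ 2 ℤ.- k) ≈ x - (⟦ + 2 ⟧ - (⟦ + 2 ⟧ + μ))
    shift = +-congˡ (-‿cong (ι≈ (constant (+ 2) ⊖ κ)))

  pairs : blockDet zero (suc zero) ⟦ + 1 ⟧ w ^ m ≈ (x - p) ^ m * (x - q) ^ m
  pairs = trans (^-congˡ m pair) (^-distrib-* _ _ m)
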